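{- Let $M$ be a countable transitive model of $\mathsf{ZF}^-$ and let $\mathbb{P}$ be a partial order that is definable over $M$. If $\mathbb{P}$ satisfies the definability lemma for either the formula "$v_0\in v_1$" or the formula "$v_0=v_1$" over $M$, then $\mathbb{P}$ satisfies the forcing theorem for all $\mathcal{L}_\in$-formulae over $M$.
   Context: We work in a model $\mathsf{V}$ of $\mathsf{ZFC}$. $\mathsf{ZF}^-$ denotes the axioms of $\mathsf{ZF}$ without the power set axiom and with Collection instead of Replacement. $\mathcal{L}_\in$ is the first-order language of set theory. "Definable over $M$" means first-order definable over $\langle M,\in\rangle$, parameters from $M$ being allowed; a partial order $\mathbb{P}$ is definable over $M$ if both its domain (a subset of $M$) and its relation $\leq_{\mathbb{P}}$ are definable over $M$. A filter $G$ on $\mathbb{P}$ is $\mathbb{P}$-generic over $M$ if it meets every dense subset of $\mathbb{P}$ that is definable over $M$. A $\mathbb{P}$-name is a set all of whose elements are of the form $\langle\tau,p\rangle$ with $\tau$ a $\mathbb{P}$-name and $p\in\mathbb{P}$; $M^{\mathbb{P}}$ is the collection of all $\mathbb{P}$-names in $M$. For a $\mathbb{P}$-generic filter $G$ let $\sigma^G=\{\tau^G\mid \exists p\in G\ \langle\tau,p\rangle\in\sigma\}$ and $M[G]=\{\sigma^G\mid\sigma\in M^{\mathbb{P}}\}$. For an $\mathcal{L}_\in$-formula $\varphi(v_0,\ldots,v_{n-1})$, $p\in\mathbb{P}$ and $\sigma_0,\ldots,\sigma_{n-1}\in M^{\mathbb{P}}$, write $p\Vdash^M_{\mathbb{P}}\varphi(\sigma_0,\ldots,\sigma_{n-1})$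 if $\varphi(\sigma_0^G,\ldots,\sigma_{n-1}^G)$ holds in $M[G]$ whenever $G$ is $\mathbb{P}$-generic over $M$ with $p\in G$. $\mathbb{P}$ satisfies the definability lemma for $\varphi$ over $M$ if the set $\{\langle p,\sigma_0,\ldots,\sigma_{n-1}\rangle\in\mathbb{P}\times M^{\mathbb{P}}\times\cdots\times M^{\mathbb{P}}\mid p\Vdash^M_{\mathbb{P}}\varphi(\sigma_0,\ldots,\sigma_{n-1})\}$ is definable over $M$. $\mathbb{P}$ satisfies the truth lemma for $\varphi$ over $M$ if for all $\sigma_0,\ldots,\sigma_{n-1}\in M^{\mathbb{P}}$ and every $\mathbb{P}$-generic filter $G$ over $M$ such that $\varphi(\sigma_0^G,\ldots,\sigma_{n-1}^G)$ holds in $M[G]$, there is $p\in G$ with $p\Vdash^M_{\mathbb{P}}\varphi(\sigma_0,\ldots,\sigma_{n-1})$. $\mathbb{P}$ satisfies the forcing theorem for $\varphi$ over $M$ if it satisfies both the definability lemma and the truth lemma for $\varphi$ over $M$. -}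

module Defs where

open import Level using (Level; Lift; _⊔_; 0ℓ) renaming (suc to lsuc)
open import Data.Bool using (Bool; true; false; if_then_else_)
open import Data.Fin using (Fin; zero; suc)
open import Data.Nat using (ℕ; zero; suc; _+_)
open import Data.Product using (Σ; Σ-syntax; ∃; ∃-syntax; _×_; _,_; proj₁; proj₂)
open import Data.Sum using (_⊎_)
open import Data.Vec using (Vec; []; _∷_; _++_; lookup; map)
open import Data.Vec.Relation.Unary.All using (All)
open import Function.Bundles using (_⇔_; mk⇔)
open import Function.Base using (_on_)
open import Function.Definitions using (StrictlySurjective)
open import Relation.Binary.Core using (Rel)
open import Relation.Binary.Structures using (IsPartialOrder)
open import Relation.Nullary using (¬_)
open import Relation.Unary using (Pred)

-- The ambient set-theoretic universe: Aczel's iterative sets, with bisimulation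
-- as equality.  Together with excluded middle (assumed where a classical
-- metatheory is needed) it plays the role of the universe in which M, ℙ, the
-- names and the generic filters live; all of these are elements of V.

data V : Set₁ where
  sup : (A : Set) → (A → V) → V

Index : V → Set
Index (sup A f) = A

infixl 25 _!_
_!_ : (x : V) → Index x → V
sup A f ! a = f a

infix 20 _≈_ _∈_ _⊆_

_≈_ : V → V → Set
sup A f ≈ sup B g = (∀ a → ∃[ b ] f a ≈ g b) × (∀ b → ∃[ a ] f a ≈ g b)

_∈_ : V → V → Set
x ∈ y = ∃[ b ] x ≈ y ! b

_⊆_ : V → V → Set₁
x ⊆ y = ∀ {z} → z ∈ x → z ∈ y

≈-refl : ∀ {x} → x ≈ x
≈-refl {sup A f} = (λ a → a , ≈-refl) , (λ a → a , ≈-refl)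

≈-sym : ∀ {x y} → x ≈ y → y ≈ x
≈-sym {sup A f} {sup B g} (l , r) =
  (λ b → proj₁ (r b) , ≈-sym (proj₂ (r b))) ,
  (λ a → proj₁ (l a) , ≈-sym (proj₂ (l a)))

≈-trans : ∀ {x y z} → x ≈ y → y ≈ z → x ≈ z
≈-trans {sup A f} {sup B g} {sup C h} (l , r) (l′ , r′) =
  (λ a → let (b , p) = l a ; (c , q) = l′ b in c , ≈-trans p q) ,
  (λ c → let (b , q) = r′ c ; (a , p) = r b in a , ≈-trans p q)

∈-respˡ : ∀ {x x′ y} → x ≈ x′ → x ∈ y → x′ ∈ y
∈-respˡ e (b , p) = b , ≈-trans (≈-sym e) p

∈-respʳ : ∀ {x y y′} → y ≈ y′ → x ∈ y → x ∈ y′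
∈-respʳ {y = sup A f} {sup B g} (l , _) (a , p) =
  let (b , q) = l a in b , ≈-trans p q

!-∈ : ∀ x (i : Index x) → x ! i ∈ x
!-∈ x i = i , ≈-refl

-- Kuratowski pairs.

｛_,_｝ : V → V → V
｛ x , y ｝ = sup Bool (λ b → if b then x else y)

⟨_,_⟩ : V → V → V
⟨ x , y ⟩ = ｛ ｛ x , x ｝ , ｛ x , y ｝ ｝

｛,｝-cong : ∀ {x x′ y y′} → x ≈ x′ → y ≈ y′ → ｛ x , y ｝ ≈ ｛ x′ , y′ ｝
｛,｝-cong p q = (λ { true → true , p ; false → false , q }) ,
               (λ { true → true , p ; false → false , q })

⟨,⟩-cong : ∀ {x x′ y y′} → x ≈ x′ → y ≈ y′ → ⟨ x , y ⟩ ≈ ⟨ x′ , y′ ⟩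
⟨,⟩-cong p q = ｛,｝-cong (｛,｝-cong p p) (｛,｝-cong p q)

-- ℒ_∈-formulae whose free variables are among v₀, …, vₙ₋₁.  In ∀′ φ the bound
-- variable is v₀ of φ.  The other connectives are the usual classical
-- abbreviations.

infix  9 _∈′_ _≐′_
infixr 7 _∧′_
infix  8 ¬′_ ∀′_

data Formula (n : ℕ) : Set where
  _∈′_ : Fin n → Fin n → Formula n
  _≐′_ : Fin n → Fin n → Formula n
  ¬′_  : Formula n → Formula n
  _∧′_ : Formula n → Formula n → Formula n
  ∀′_  : Formula (suc n) → Formula n

v₀∈v₁ : Formula 2
v₀∈v₁ = zero ∈′ suc zero

v₀≐v₁ : Formula 2
v₀≐v₁ = zero ≐′ suc zero

-- C ⊨ φ [ ρ ] is satisfaction in the structure ⟨C, ∈⟩.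

infix 4 _⊨_[_]
_⊨_[_] : ∀ {ℓ n} → Pred V ℓ → Formula n → Vec V n → Set (lsuc 0ℓ ⊔ ℓ)
_⊨_[_] {ℓ} C (i ∈′ j) ρ = Lift (lsuc 0ℓ ⊔ ℓ) (lookup ρ i ∈ lookup ρ j)
_⊨_[_] {ℓ} C (i ≐′ j) ρ = Lift (lsuc 0ℓ ⊔ ℓ) (lookup ρ i ≈ lookup ρ j)
C ⊨ ¬′ φ   [ ρ ] = ¬ (C ⊨ φ [ ρ ])
C ⊨ φ ∧′ ψ [ ρ ] = (C ⊨ φ [ ρ ]) × (C ⊨ ψ [ ρ ])
C ⊨ ∀′ φ   [ ρ ] = ∀ x → C x → C ⊨ φ [ x ∷ ρ ]

Countable : V → Set
Countable M = Σ[ e ∈ (ℕ → Index M) ] StrictlySurjective (_≈_ on (M !_)) e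

Transitive : V → Set₁
Transitive M = ∀ {x y} → x ∈ y → y ∈ M → x ∈ M

-- ⟨M, ∈⟩ satisfies ZF⁻: every quantifier of each axiom is relativized to M.

record ZF⁻ (M : V) : Set₁ where
  field
    extensionality : ∀ x y → x ∈ M → y ∈ M →
      (∀ z → z ∈ M → z ∈ x ⇔ z ∈ y) → x ≈ y
    foundation : ∀ x → x ∈ M → (∃[ y ] y ∈ M × y ∈ x) →
      ∃[ y ] y ∈ M × y ∈ x × ¬ (∃[ z ] z ∈ M × z ∈ x × z ∈ y)
    pairing : ∀ x y → x ∈ M → y ∈ M →
      ∃[ u ] u ∈ M × (∀ z → z ∈ M → z ∈ u ⇔ (z ≈ x ⊎ z ≈ y))
    union : ∀ x → x ∈ M →
      ∃[ u ] u ∈ M × (∀ z → z ∈ M → z ∈ u ⇔ (∃[ y ] y ∈ M × y ∈ x × z ∈ y))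
    infinity : ∃[ w ] w ∈ M ×
      (∃[ o ] o ∈ M × o ∈ w × (∀ z → z ∈ M → ¬ z ∈ o)) ×
      (∀ x → x ∈ M → x ∈ w →
        ∃[ s ] s ∈ M × s ∈ w × (∀ z → z ∈ M → z ∈ s ⇔ (z ∈ x ⊎ z ≈ x)))
    separation : ∀ {n} (φ : Formula (1 + n)) (as : Vec V n) → All (_∈ M) as →
      ∀ x → x ∈ M →
      ∃[ y ] y ∈ M × (∀ z → z ∈ M → z ∈ y ⇔ (z ∈ x × ((_∈ M) ⊨ φ [ z ∷ as ])))
    collection : ∀ {n} (φ : Formula (2 + n)) (as : Vec V n) → All (_∈ M) as →
      ∀ x → x ∈ M →
      (∀ y → y ∈ M → y ∈ x → ∃[ z ] z ∈ M × ((_∈ M) ⊨ φ [ y ∷ z ∷ as ])) →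
      ∃[ c ] c ∈ M × (∀ y → y ∈ M → y ∈ x →
        ∃[ z ] z ∈ M × z ∈ c × ((_∈ M) ⊨ φ [ y ∷ z ∷ as ]))

-- R is a subset of Mᵏ that is first-order definable over ⟨M, ∈⟩ from the
-- parameters as ∈ M.

Definable : ∀ {k ℓ} → V → (Vec V k → Set ℓ) → Set (lsuc 0ℓ ⊔ ℓ)
Definable {k} M R =
  ∃[ m ] Σ[ φ ∈ Formula (k + m) ] Σ[ as ∈ Vec V m ] All (_∈ M) as ×
    (∀ xs → R xs ⇔ (All (_∈ M) xs × ((_∈ M) ⊨ φ [ xs ++ as ])))

ElementOf : V → Vec V 1 → Set
ElementOf X (x ∷ []) = x ∈ X

DefinableSet : V → V → Set₁
DefinableSet M X = Definable M (ElementOf X)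

record PartialOrder : Set₁ where
  field
    dom : V
    rel : V

  _≤_ : V → V → Set
  p ≤ q = ⟨ p , q ⟩ ∈ rel

  Element : Set₁
  Element = ∃[ p ] p ∈ dom

  _≈ᴾ_ : Rel Element 0ℓ
  _≈ᴾ_ = _≈_ on proj₁

  _≤ᴾ_ : Rel Element 0ℓ
  _≤ᴾ_ = _≤_ on proj₁

  field
    rel⊆dom×dom    : ∀ {z} → z ∈ rel →
      ∃[ p ] ∃[ q ] p ∈ dom × q ∈ dom × z ≈ ⟨ p , q ⟩
    isPartialOrder : IsPartialOrder _≈ᴾ_ _≤ᴾ_

open PartialOrder using (dom)

OrderRelation : PartialOrder → Vec V 2 → Set
OrderRelation ℙ (p ∷ q ∷ []) = PartialOrder._≤_ ℙ p q

DefinableOrder : V → PartialOrder → Set₁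
DefinableOrder M ℙ = DefinableSet M (dom ℙ) × Definable M (OrderRelation ℙ)

record IsFilter (ℙ : PartialOrder) (G : V) : Set₁ where
  open PartialOrder ℙ using (_≤_)
  field
    subset   : G ⊆ dom ℙ
    nonempty : ∃[ p ] p ∈ G
    upward   : ∀ {p q} → p ∈ G → q ∈ dom ℙ → p ≤ q → q ∈ G
    directed : ∀ {p q} → p ∈ G → q ∈ G → ∃[ r ] r ∈ G × r ≤ p × r ≤ q

record IsDense (ℙ : PartialOrder) (D : V) : Set₁ where
  open PartialOrder ℙ using (_≤_)
  field
    subset : D ⊆ dom ℙ
    dense  : ∀ {p} → p ∈ dom ℙ → ∃[ q ] q ∈ D × q ≤ p

record IsGeneric (M : V) (ℙ : PartialOrder) (G : V) : Set₁ where
  field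
    isFilter : IsFilter ℙ G
    meets    : ∀ D → IsDense ℙ D → DefinableSet M D → ∃[ p ] p ∈ G × p ∈ D

data IsName (ℙ : PartialOrder) : V → Set₁ where
  name : ∀ {σ} →
    (∀ {z} → z ∈ σ → ∃[ τ ] ∃[ p ] z ≈ ⟨ τ , p ⟩ × IsName ℙ τ × p ∈ dom ℙ) →
    IsName ℙ σ

_^_ : V → PartialOrder → Pred V (lsuc 0ℓ)
(M ^ ℙ) σ = σ ∈ M × IsName ℙ σ

-- val G σ is σ^G.  If ⟨τ, p⟩ ∈ σ, then τ occurs (up to ≈) as an element of an
-- element of an element of σ, which makes the recursion structural: val² G x i j
-- is val G (x ! i ! j).  The recursion equation
-- σ^G = {τ^G ∣ ∃ p ∈ G, ⟨τ, p⟩ ∈ σ} is ∈-val below.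

val  : V → V → V
val¹ : (G x : V) → Index x → V
val² : (G x : V) (i : Index x) → Index (x ! i) → V

val G (sup A f) =
  sup (Σ[ a ∈ A ] Σ[ i ∈ Index (f a) ] Σ[ j ∈ Index (f a ! i) ] Σ[ k ∈ Index G ]
        f a ≈ ⟨ f a ! i ! j , G ! k ⟩)
      (λ (a , i , j , _) → val² G (f a) i j)
val¹ G (sup A f) a = val G (f a)
val² G (sup A f) a i = val¹ G (f a) i

val²-≡ : ∀ G x i j → val² G x i j ≈ val G (x ! i ! j)
val²-≡ G (sup A f) a i with f a
... | sup B g = ≈-refl

val-cong  : ∀ G {x y} → x ≈ y → val G x ≈ val G y
val¹-cong : ∀ G {x y} → x ≈ y → ∀ i →
  ∃[ i′ ] x ! i ≈ y ! i′ × val¹ G x i ≈ val¹ G y i′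
val²-cong : ∀ G {x y} → x ≈ y → ∀ i j →
  ∃[ i′ ] ∃[ j′ ] x ! i ! j ≈ y ! i′ ! j′ × val² G x i j ≈ val² G y i′ j′

val-cong G {sup A f} {sup B g} (l , r) =
  (λ (a , i , j , k , e) →
    let (b , fa≈gb) = l a
        (i′ , j′ , p , q) = val²-cong G fa≈gb i j
    in (b , i′ , j′ , k ,
        ≈-trans (≈-sym fa≈gb) (≈-trans e (⟨,⟩-cong p ≈-refl))) , q) ,
  (λ (b , i , j , k , e) →
    let (a , fa≈gb) = r b
        (i′ , j′ , p , q) = val²-cong G (≈-sym fa≈gb) i j
    in (a , i′ , j′ , k ,
        ≈-trans fa≈gb (≈-trans e (⟨,⟩-cong p ≈-refl))) , ≈-sym q)
val¹-cong G {sup A f} {sup B g} (l , r) a =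
  let (b , e) = l a in b , e , val-cong G e
val²-cong G {sup A f} {sup B g} (l , r) a i =
  let (b , e) = l a
      (i′ , p , q) = val¹-cong G e i
  in b , i′ , p , q

∈-val : ∀ G σ x →
  x ∈ val G σ ⇔ (∃[ τ ] ∃[ p ] p ∈ G × ⟨ τ , p ⟩ ∈ σ × x ≈ val G τ)
∈-val G (sup A f) x = mk⇔
  (λ ((a , i , j , k , e) , q) →
    f a ! i ! j , G ! k , !-∈ G k , (a , ≈-sym e) ,
    ≈-trans q (val²-≡ G (f a) i j))
  (λ (τ , p , (k , p≈) , (a , e) , q) →
    let (i , j , t , _) = val²-cong G e true true
    in (a , i , j , k , ≈-trans (≈-sym e) (⟨,⟩-cong t p≈)) ,
       ≈-trans q (≈-trans (val-cong G t) (≈-sym (val²-≡ G (f a) i j))))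

_[_]^_ : V → V → PartialOrder → Pred V (lsuc 0ℓ)
(M [ G ]^ ℙ) x = ∃[ σ ] (M ^ ℙ) σ × x ≈ val G σ

Forces : ∀ {n} → V → (ℙ : PartialOrder) → V → Formula n → Vec V n → Set₁
Forces M ℙ p φ σs =
  ∀ G → IsGeneric M ℙ G → p ∈ G → M [ G ]^ ℙ ⊨ φ [ map (val G) σs ]

ForcingRelation : ∀ {n} → V → PartialOrder → Formula n → Vec V (suc n) → Set₁
ForcingRelation M ℙ φ (p ∷ σs) =
  p ∈ dom ℙ × All (M ^ ℙ) σs × Forces M ℙ p φ σs

DefinabilityLemma : ∀ {n} → V → PartialOrder → Formula n → Set₁
DefinabilityLemma M ℙ φ = Definable M (ForcingRelation M ℙ φ)

TruthLemma : ∀ {n} → V → PartialOrder → Formula n → Set₁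
TruthLemma M ℙ φ = ∀ σs → All (M ^ ℙ) σs → ∀ G → IsGeneric M ℙ G →
  M [ G ]^ ℙ ⊨ φ [ map (val G) σs ] → ∃[ p ] p ∈ G × Forces M ℙ p φ σs

ForcingTheorem : ∀ {n} → V → PartialOrder → Formula n → Set₁
ForcingTheorem M ℙ φ = DefinabilityLemma M ℙ φ × TruthLemma M ℙ φ

-- p ⊩ σ = τ is definable from the forcing relation of v₀ ∈ v₁: it holds iff, for
-- every ⟨π, r⟩ ∈ σ, each q ≤ p, r forces π ∈ τ, and symmetrically.  So let the
-- forcing relation of v₀ = v₁ be definable.  The truth lemma for v₀ = v₁ is proved
-- by ∈-induction on names: the class of all p which either force σ = τ, or lie
-- below some r with ⟨π, r⟩ ∈ σ such that no q ≤ p satisfies q ≤ r′ and q ⊩ π = ρ for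
-- any ⟨ρ, r′⟩ ∈ τ, or do so with σ and τ exchanged, is dense and definable.  Then
-- p ⊩ σ ∈ τ iff the q which are below some r with ⟨ρ, r⟩ ∈ τ and q ⊩ σ = ρ are
-- dense below p.  The remaining formulae follow by induction, where p ⊩ ¬φ iff no
-- q ≤ p forces φ, and p ⊩ ∀x φ iff p ⊩ φ(σ) for all names σ.

module Submission where

open import Defs
open PartialOrder using (dom; rel)
open import Level using (0ℓ; lift; lower; _⊔_) renaming (suc to lsuc)
open import Axiom.ExcludedMiddle using (ExcludedMiddle)
open import Data.Bool using (true; false)
open import Data.Empty using (⊥-elim)
open import Data.Fin using (Fin; zero; suc; _↑ˡ_; _↑ʳ_; splitAt)
open import Data.Fin.Base using () renaming (lift to liftᶠ)
open import Data.Fin.Patterns using (0F; 1F; 2F; 3F; 4F; 5F)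
open import Data.List using (List; []; _∷_; cartesianProduct; cartesianProductWith; concatMap; upTo; allFin)
  renaming (map to mapˡ; _++_ to _++ˡ_)
open import Data.List.Membership.Propositional using () renaming (_∈_ to _∈ˡ_)
open import Data.List.Membership.Propositional.Properties
  using (∈-map⁺; ∈-++⁺ˡ; ∈-++⁺ʳ; ∈-concatMap⁺; ∈-cartesianProductWith⁺; ∈-cartesianProduct⁺; ∈-upTo⁺; ∈-allFin)
open import Data.List.Relation.Unary.Any using (here; there) renaming (map to mapAny)
open import Data.Nat using (ℕ; zero; suc; _+_; s≤s; _≤′_; ≤′-refl; ≤′-step)
  renaming (_≤_ to _≤ⁿ_; _⊔_ to _⊔ⁿ_)
open import Data.Nat.Properties using (m≤m⊔n; m≤n⊔m; ≤⇒≤′; m⊔n≤o⇒m≤o; m⊔n≤o⇒n≤o)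
  renaming (≤-trans to ≤ⁿ-trans)
open import Data.Product using (Σ-syntax; ∃-syntax; _×_; _,_; proj₁; proj₂; map₂)
open import Data.Product.Function.NonDependent.Propositional using (_×-⇔_)
open import Data.Sum using (_⊎_; inj₁; inj₂; [_,_]′)
open import Data.Vec using (Vec; []; _∷_; _++_; lookup; map; head; tail)
open import Data.Vec.Properties using (lookup-++ˡ; lookup-++ʳ; lookup-splitAt; lookup-map)
open import Data.Vec.Relation.Unary.All as All using (All; []; _∷_)
open import Data.Vec.Relation.Unary.All.Properties using (++⁺; lookup⁺; lookup⁻)
open import Data.Vec.Relation.Binary.Pointwise.Inductive as Pointwise using (Pointwise; []; _∷_)
open import Function using (_∘_; id; _⇔_; mk⇔)
open import Function.Bundles using (Equivalence)
open import Function.Construct.Composition using (_⇔-∘_)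
open import Function.Construct.Identity using (⇔-id)
open import Function.Construct.Symmetry using (⇔-sym)
open import Induction.WellFounded using (Acc; acc; WellFounded; module Subrelation)
open import Relation.Binary.Construct.Closure.Transitive using (TransClosure; [_]; _∷_) renaming (wellFounded to ⁺-wellFounded)
open import Relation.Binary.PropositionalEquality using (_≡_; refl; sym; trans; cong; subst)
open import Relation.Binary.Structures using (IsPartialOrder)
open import Relation.Nullary using (¬_; Dec; yes; no)
open import Relation.Nullary.Decidable using (True; toWitness; fromWitness; decidable-stable)
open import Relation.Unary using (Pred)
open Equivalence using (to; from)

-- Sets, ordered pairs and names

⊆-antisym : ∀ {x y} → x ⊆ y → y ⊆ x → x ≈ y
⊆-antisym {sup A f} {sup B g} x⊆y y⊆x =
  (λ a → x⊆y (!-∈ (sup A f) a)) ,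
  (λ b → let (a , e) = y⊆x (!-∈ (sup B g) b) in a , ≈-sym e)

∈｛,｝⁻ : ∀ {x y z} → z ∈ ｛ x , y ｝ → z ≈ x ⊎ z ≈ y
∈｛,｝⁻ (true  , e) = inj₁ e
∈｛,｝⁻ (false , e) = inj₂ e

∈｛,｝ˡ : ∀ {x y} → x ∈ ｛ x , y ｝
∈｛,｝ˡ = true , ≈-refl

∈｛,｝ʳ : ∀ {x y} → y ∈ ｛ x , y ｝
∈｛,｝ʳ = false , ≈-refl

｛,｝-unique : ∀ {x y z} → x ∈ z → y ∈ z → (∀ {w} → w ∈ z → w ≈ x ⊎ w ≈ y) → z ≈ ｛ x , y ｝
｛,｝-unique {z = z} x∈z y∈z only = ⊆-antisym
  (λ w∈z → [ true ,_ , false ,_ ]′ (only w∈z))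
  (λ w∈ → [ (λ e → ∈-respˡ {y = z} (≈-sym e) x∈z) , (λ e → ∈-respˡ {y = z} (≈-sym e) y∈z) ]′ (∈｛,｝⁻ w∈))

∈-singleton : ∀ {x z} → z ∈ ｛ x , x ｝ → z ≈ x
∈-singleton = [ id , id ]′ ∘ ∈｛,｝⁻

⟨,⟩-injectiveˡ : ∀ {x y x′ y′} → ⟨ x , y ⟩ ≈ ⟨ x′ , y′ ⟩ → x ≈ x′
⟨,⟩-injectiveˡ e with ∈｛,｝⁻ (∈-respʳ e ∈｛,｝ˡ)
... | inj₁ s = ≈-sym (∈-singleton (∈-respʳ (≈-sym s) ∈｛,｝ˡ))
... | inj₂ s = ≈-sym (∈-singleton (∈-respʳ (≈-sym s) ∈｛,｝ˡ))

⟨,⟩-second : ∀ {x y x′ y′} → ⟨ x , y ⟩ ≈ ⟨ x′ , y′ ⟩ → y ≈ x′ ⊎ y ≈ y′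
⟨,⟩-second e with ∈｛,｝⁻ (∈-respʳ e ∈｛,｝ʳ)
... | inj₁ s = inj₁ (∈-singleton (∈-respʳ s ∈｛,｝ʳ))
... | inj₂ s = ∈｛,｝⁻ (∈-respʳ s ∈｛,｝ʳ)

-- Comparing second components in both directions leaves only the crossed case `y ≈ x′`, `y′ ≈ x`,
-- which injectivity in the first component resolves.
⟨,⟩-injectiveʳ : ∀ {x y x′ y′} → ⟨ x , y ⟩ ≈ ⟨ x′ , y′ ⟩ → y ≈ y′
⟨,⟩-injectiveʳ e with ⟨,⟩-second e | ⟨,⟩-second (≈-sym e)
... | inj₂ y≈y′ | _          = y≈y′
... | inj₁ _    | inj₂ y′≈y  = ≈-sym y′≈y
... | inj₁ y≈x′ | inj₁ y′≈x  =
  ≈-trans y≈x′ (≈-trans (≈-sym (⟨,⟩-injectiveˡ e)) (≈-sym y′≈x))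

∈-wellFounded : WellFounded _∈_
∈-wellFounded x = accessible x ≈-refl
  where
  -- Generalised to all `y ≈ x`, because a member of a set is only bisimilar to one of its subtrees,
  -- while the recursion runs on the subtrees.
  accessible : ∀ x {y} → y ≈ x → Acc _∈_ y
  accessible (sup A f) e = acc λ z∈y → let (a , q) = ∈-respʳ e z∈y in accessible (f a) q

_⊏_ : V → V → Set₁
τ ⊏ σ = ∃[ p ] ⟨ τ , p ⟩ ∈ σ

-- With Kuratowski pairs, `τ ∈ {τ} ∈ ⟨τ, p⟩ ∈ σ`, so `⊏` is contained in the transitive closure of
-- `∈`.
⊏-wellFounded : WellFounded _⊏_
⊏-wellFounded = Subrelation.wellFounded ⊏⇒∈⁺ (⁺-wellFounded _ ∈-wellFounded)
  where
  ⊏⇒∈⁺ : ∀ {τ σ} → τ ⊏ σ → TransClosure _∈_ τ σ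
  ⊏⇒∈⁺ (p , τp∈σ) = ∈｛,｝ˡ ∷ ∈｛,｝ˡ ∷ [ τp∈σ ]

IsName-resp : ∀ {ℙ σ τ} → σ ≈ τ → IsName ℙ σ → IsName ℙ τ
IsName-resp e (name h) = name (h ∘ ∈-respʳ (≈-sym e))

IsName-component : ∀ {ℙ σ τ p} → IsName ℙ σ → ⟨ τ , p ⟩ ∈ σ → IsName ℙ τ × p ∈ dom ℙ
IsName-component {ℙ} (name h) τp∈σ with h τp∈σ
... | τ′ , p′ , e , nτ′ , p′∈ℙ =
  IsName-resp (≈-sym (⟨,⟩-injectiveˡ e)) nτ′ , ∈-respˡ {y = dom ℙ} (≈-sym (⟨,⟩-injectiveʳ e)) p′∈ℙ

val-⊆ : ∀ G σ τ →
  (∀ {π r} → ⟨ π , r ⟩ ∈ σ → r ∈ G → val G π ∈ val G τ) → val G σ ⊆ val G τ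
val-⊆ G σ τ h x∈ = let (π , r , r∈G , πr∈σ , e) = to (∈-val G σ _) x∈
                     in ∈-respˡ {y = val G τ} (≈-sym e) (h πr∈σ r∈G)

∈-val⁺ : ∀ G σ {τ p} → ⟨ τ , p ⟩ ∈ σ → p ∈ G → val G τ ∈ val G σ
∈-val⁺ G σ τp∈σ p∈G = from (∈-val G σ _) (_ , _ , p∈G , τp∈σ , ≈-refl)

-- Satisfaction

⊨-resp : ∀ {ℓ n} {C : Pred V ℓ} (φ : Formula n) {ρ ρ′} →
  Pointwise _≈_ ρ ρ′ → C ⊨ φ [ ρ ] → C ⊨ φ [ ρ′ ]
⊨-resp (i ∈′ j) {ρ′ = ρ′} es (lift h) =
  lift (∈-respˡ {y = lookup ρ′ j} (Pointwise.lookup es i) (∈-respʳ (Pointwise.lookup es j) h))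
⊨-resp (i ≐′ j) es (lift h) =
  lift (≈-trans (≈-sym (Pointwise.lookup es i)) (≈-trans h (Pointwise.lookup es j)))
⊨-resp (¬′ φ)   es h = h ∘ ⊨-resp φ (Pointwise.sym ≈-sym es)
⊨-resp (φ ∧′ ψ) es (g , h) = ⊨-resp φ es g , ⊨-resp ψ es h
⊨-resp (∀′ φ)   es h x x∈C = ⊨-resp φ (≈-refl ∷ es) (h x x∈C)

Pointwise-≈-refl : ∀ {n} {ρ : Vec V n} → Pointwise _≈_ ρ ρ
Pointwise-≈-refl = Pointwise.refl ≈-refl

rename : ∀ {m n} → (Fin m → Fin n) → Formula m → Formula n
rename f (i ∈′ j) = f i ∈′ f j
rename f (i ≐′ j) = f i ≐′ f j
rename f (¬′ φ)   = ¬′ rename f φ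
rename f (φ ∧′ ψ) = rename f φ ∧′ rename f ψ
rename f (∀′ φ)   = ∀′ rename (liftᶠ 1 f) φ

⊨-rename : ∀ {ℓ m n} {C : Pred V ℓ} (f : Fin m → Fin n) φ {ρ ρ′} →
  (∀ i → lookup ρ′ (f i) ≡ lookup ρ i) → C ⊨ rename f φ [ ρ′ ] ⇔ C ⊨ φ [ ρ ]
⊨-rename f (i ∈′ j) {ρ} {ρ′} e rewrite e i | e j = ⇔-id _
⊨-rename f (i ≐′ j) {ρ} {ρ′} e rewrite e i | e j = ⇔-id _
⊨-rename f (¬′ φ)   e = let q = ⊨-rename f φ e in mk⇔ (_∘ from q) (_∘ to q)
⊨-rename f (φ ∧′ ψ) e = ⊨-rename f φ e ×-⇔ ⊨-rename f ψ e
⊨-rename f (∀′ φ)   e =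
  let q x = ⊨-rename (liftᶠ 1 f) φ {x ∷ _} {x ∷ _} λ { zero → refl ; (suc i) → e i }
  in mk⇔ (λ h x x∈C → to (q x) (h x x∈C)) (λ h x x∈C → from (q x) (h x x∈C))

-- Arguments and parameters form two blocks of variables that move independently; this is what
-- merging parameter lists requires.
reindex : ∀ {k m n} → (Fin k → Fin n) → (Fin m → Fin n) → Formula (k + m) → Formula n
reindex {k} f g = rename ([ f , g ]′ ∘ splitAt k)

⊨-reindex : ∀ {ℓ k m n} {C : Pred V ℓ} (f : Fin k → Fin n) (g : Fin m → Fin n) φ
  (xs : Vec V k) (as : Vec V m) {ρ : Vec V n} →
  (∀ i → lookup ρ (f i) ≡ lookup xs i) → (∀ j → lookup ρ (g j) ≡ lookup as j) →
  C ⊨ reindex f g φ [ ρ ] ⇔ C ⊨ φ [ xs ++ as ]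
⊨-reindex {k = k} f g φ xs as {ρ} ef eg = ⊨-rename _ φ λ i →
  trans (split (splitAt k i)) (sym (lookup-splitAt k xs as i))
  where
  split : ∀ s → lookup ρ ([ f , g ]′ s) ≡ [ lookup xs , lookup as ]′ s
  split (inj₁ i) = ef i
  split (inj₂ j) = eg j

-- Enumeration of formulae with parameters

depth : ∀ {n} → Formula n → ℕ
depth (_ ∈′ _) = 1
depth (_ ≐′ _) = 1
depth (¬′ φ)   = suc (depth φ)
depth (φ ∧′ ψ) = suc (depth φ ⊔ⁿ depth ψ)
depth (∀′ φ)   = suc (depth φ)

-- Countability of the formulae takes the form of finite lists that exhaust them, so that a
-- descending sequence of conditions can treat a whole list at each stage.
formulasBelow : ℕ → ∀ n → List (Formula n)
formulasBelow zero    n = []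
formulasBelow (suc d) n =
  cartesianProductWith _∈′_ (allFin n) (allFin n) ++ˡ
  cartesianProductWith _≐′_ (allFin n) (allFin n) ++ˡ
  mapˡ ¬′_ (formulasBelow d n) ++ˡ
  cartesianProductWith _∧′_ (formulasBelow d n) (formulasBelow d n) ++ˡ
  mapˡ ∀′_ (formulasBelow d (suc n))

∈-formulasBelow : ∀ {d n} (φ : Formula n) → depth φ ≤ⁿ d → φ ∈ˡ formulasBelow d n
∈-formulasBelow (i ∈′ j) (s≤s _) =
  ∈-++⁺ˡ (∈-cartesianProductWith⁺ _∈′_ (∈-allFin i) (∈-allFin j))
∈-formulasBelow {suc d} {n} (i ≐′ j) (s≤s _) =
  ∈-++⁺ʳ (cartesianProductWith _∈′_ (allFin n) (allFin n))
  (∈-++⁺ˡ (∈-cartesianProductWith⁺ _≐′_ (∈-allFin i) (∈-allFin j)))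
∈-formulasBelow {suc d} {n} (¬′ φ) (s≤s le) =
  ∈-++⁺ʳ (cartesianProductWith _∈′_ (allFin n) (allFin n))
  (∈-++⁺ʳ (cartesianProductWith _≐′_ (allFin n) (allFin n))
  (∈-++⁺ˡ (∈-map⁺ ¬′_ (∈-formulasBelow φ le))))
∈-formulasBelow {suc d} {n} (φ ∧′ ψ) (s≤s le) =
  ∈-++⁺ʳ (cartesianProductWith _∈′_ (allFin n) (allFin n))
  (∈-++⁺ʳ (cartesianProductWith _≐′_ (allFin n) (allFin n))
  (∈-++⁺ʳ (mapˡ ¬′_ (formulasBelow d n))
  (∈-++⁺ˡ (∈-cartesianProductWith⁺ _∧′_
    (∈-formulasBelow φ (m⊔n≤o⇒m≤o (depth φ) (depth ψ) le))
    (∈-formulasBelow ψ (m⊔n≤o⇒n≤o (depth φ) (depth ψ) le))))))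
∈-formulasBelow {suc d} {n} (∀′ φ) (s≤s le) =
  ∈-++⁺ʳ (cartesianProductWith _∈′_ (allFin n) (allFin n))
  (∈-++⁺ʳ (cartesianProductWith _≐′_ (allFin n) (allFin n))
  (∈-++⁺ʳ (mapˡ ¬′_ (formulasBelow d n))
  (∈-++⁺ʳ (cartesianProductWith _∧′_ (formulasBelow d n) (formulasBelow d n))
  (∈-map⁺ ∀′_ (∈-formulasBelow φ le)))))

bound : ∀ {m} → Vec ℕ m → ℕ
bound []       = 0
-- The successor makes the bound strict, since `upTo d` stops before `d`.
bound (k ∷ ks) = suc k ⊔ⁿ bound ks

vectorsBelow : ℕ → ∀ m → List (Vec ℕ m)
vectorsBelow d zero    = [] ∷ []
vectorsBelow d (suc m) = cartesianProductWith _∷_ (upTo d) (vectorsBelow d m)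

∈-vectorsBelow : ∀ {d m} (ks : Vec ℕ m) → bound ks ≤ⁿ d → ks ∈ˡ vectorsBelow d m
∈-vectorsBelow []       _  = here refl
∈-vectorsBelow (k ∷ ks) le = ∈-cartesianProductWith⁺ _∷_
  (∈-upTo⁺ (m⊔n≤o⇒m≤o (suc k) (bound ks) le))
  (∈-vectorsBelow ks (m⊔n≤o⇒n≤o (suc k) (bound ks) le))

-- A code stands for a subset of `M` definable with parameters; the parameters are given by their
-- indices in an enumeration of `M`.
Code : Set
Code = Σ[ m ∈ ℕ ] Formula (1 + m) × Vec ℕ m

codesBelow : ℕ → List Code
codesBelow d = concatMap
  (λ m → mapˡ (m ,_) (cartesianProduct (formulasBelow d (1 + m)) (vectorsBelow d m))) (upTo d)

rank : Code → ℕ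
rank (m , φ , ks) = suc m ⊔ⁿ (depth φ ⊔ⁿ bound ks)

∈-codesBelow : ∀ c → c ∈ˡ codesBelow (rank c)
∈-codesBelow (m , φ , ks) = ∈-concatMap⁺
  (λ m → mapˡ (m ,_) (cartesianProduct (formulasBelow d (1 + m)) (vectorsBelow d m)))
  (mapAny (λ { refl → ∈-map⁺ (m ,_) (∈-cartesianProduct⁺
      (∈-formulasBelow φ (≤ⁿ-trans (m≤m⊔n (depth φ) (bound ks)) (m≤n⊔m (suc m) _)))
      (∈-vectorsBelow ks (≤ⁿ-trans (m≤n⊔m (depth φ) (bound ks)) (m≤n⊔m (suc m) _)))) })
    (∈-upTo⁺ (m≤m⊔n (suc m) (depth φ ⊔ⁿ bound ks))))
  where d = rank (m , φ , ks)

-- Definability over M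

module _ (em : ExcludedMiddle (lsuc 0ℓ)) where

  byContradiction : {A : Set₁} → ¬ ¬ A → A
  byContradiction = decidable-stable em

  module _ (M : V) (M-transitive : Transitive M) where

    -- Unlike in Definable, R need not be a subset of Mᵏ.
    record Def {k ℓ} (R : Vec V k → Set ℓ) : Set (lsuc 0ℓ ⊔ ℓ) where
      constructor def
      field
        {arity}      : ℕ
        formula      : Formula (k + arity)
        parameters   : Vec V arity
        parameters∈M : All (_∈ M) parameters
        defines      : ∀ {xs} → All (_∈ M) xs →
          R xs ⇔ ((_∈ M) ⊨ formula [ xs ++ parameters ])

    Definable⇒Def : ∀ {k ℓ} {R : Vec V k → Set ℓ} → Definable M R → Def R
    Definable⇒Def (_ , φ , as , as∈M , h) =
      def φ as as∈M λ xs∈M → mk⇔ (proj₂ ∘ to (h _)) (from (h _) ∘ (xs∈M ,_))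

    Def⇒Definable : ∀ {k ℓ} {R : Vec V k → Set ℓ} →
      (∀ {xs} → R xs → All (_∈ M) xs) → Def R → Definable M R
    Def⇒Definable R⊆M (def φ as as∈M h) = _ , φ , as , as∈M , λ xs →
      mk⇔ (λ r → R⊆M r , to (h (R⊆M r)) r) (λ (xs∈M , s) → from (h xs∈M) s)

    def-cong : ∀ {k ℓ ℓ′} {R : Vec V k → Set ℓ} {S : Vec V k → Set ℓ′} →
      (∀ {xs} → All (_∈ M) xs → R xs ⇔ S xs) → Def R → Def S
    def-cong e (def φ as as∈M h) = def φ as as∈M λ xs∈M → h xs∈M ⇔-∘ ⇔-sym (e xs∈M)

    -- Satisfaction respects `≈`, hence so does everything definable on `M`, whatever its own
    -- definition looks like.
    def-resp : ∀ {k ℓ} {R : Vec V k → Set ℓ} → Def R → ∀ {xs ys} →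
      All (_∈ M) xs → All (_∈ M) ys → Pointwise _≈_ xs ys → R xs → R ys
    def-resp (def φ as as∈M h) xs∈M ys∈M es =
      from (h ys∈M) ∘ ⊨-resp φ (Pointwise.++⁺ es Pointwise-≈-refl) ∘ to (h xs∈M)

    def-¬ : ∀ {k ℓ} {R : Vec V k → Set ℓ} → Def R → Def (λ xs → ¬ R xs)
    def-¬ (def φ as as∈M h) = def (¬′ φ) as as∈M λ xs∈M →
      mk⇔ (_∘ from (h xs∈M)) (_∘ to (h xs∈M))

    infixr 6 _∧ᵈ_
    _∧ᵈ_ : ∀ {k ℓ ℓ′} {R : Vec V k → Set ℓ} {S : Vec V k → Set ℓ′} →
      Def R → Def S → Def (λ xs → R xs × S xs)
    _∧ᵈ_ {k} (def {m} φ as as∈M h) (def {n} ψ bs bs∈M h′) =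
      def (reindex (_↑ˡ (m + n)) (λ i → k ↑ʳ (i ↑ˡ n)) φ ∧′
           reindex (_↑ˡ (m + n)) (λ i → k ↑ʳ (m ↑ʳ i)) ψ)
        (as ++ bs) (++⁺ as∈M bs∈M) λ {xs} xs∈M →
          (⇔-sym (⊨-reindex _ _ φ xs as (lookup-++ˡ xs (as ++ bs))
              (λ i → trans (lookup-++ʳ xs (as ++ bs) (i ↑ˡ n)) (lookup-++ˡ as bs i)))
            ⇔-∘ h xs∈M)
          ×-⇔
          (⇔-sym (⊨-reindex _ _ ψ xs bs (lookup-++ˡ xs (as ++ bs))
              (λ i → trans (lookup-++ʳ xs (as ++ bs) (m ↑ʳ i)) (lookup-++ʳ as bs i)))
            ⇔-∘ h′ xs∈M)

    def-∀ : ∀ {k ℓ} {R : Vec V (suc k) → Set ℓ} → Def R →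
      Def (λ xs → ∀ x → x ∈ M → R (x ∷ xs))
    def-∀ (def φ as as∈M h) = def (∀′ φ) as as∈M λ xs∈M → mk⇔
      (λ r x x∈M → to (h (x∈M ∷ xs∈M)) (r x x∈M))
      (λ s x x∈M → from (h (x∈M ∷ xs∈M)) (s x x∈M))

    -- `R` may live in any universe, so excluded middle is applied to its defining formula, whose
    -- satisfaction lives in `Set₁`.
    def-stable : ∀ {k ℓ} {R : Vec V k → Set ℓ} → Def R → ∀ {xs} →
      All (_∈ M) xs → ¬ ¬ R xs → R xs
    def-stable (def φ as as∈M h) xs∈M ¬¬r =
      from (h xs∈M) (byContradiction λ ¬s → ¬¬r (¬s ∘ to (h xs∈M)))

    def-∃ : ∀ {k ℓ} {R : Vec V (suc k) → Set ℓ} → Def R →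
      Def (λ xs → ∃[ x ] x ∈ M × R (x ∷ xs))
    def-∃ d@(def φ as as∈M h) = def-cong
      (λ {xs} xs∈M → mk⇔
        -- The witness is found on the side of satisfaction, where excluded middle is available, and
        -- then carried back to `R`.
        (λ ¬∀¬ →
          let (x , x∈M , s) =
                byContradiction {∃[ x ] x ∈ M × ((_∈ M) ⊨ φ [ x ∷ xs ++ as ])} λ ¬∃ →
                  ¬∀¬ λ x x∈M r → ¬∃ (x , x∈M , to (h (x∈M ∷ xs∈M)) r)
          in x , x∈M , from (h (x∈M ∷ xs∈M)) s)
        (λ (x , x∈M , r) ∀¬ → ∀¬ x x∈M r))
      (def-¬ (def-∀ (def-¬ d)))

    infixr 4 _→ᵈ_
    _→ᵈ_ : ∀ {k ℓ ℓ′} {R : Vec V k → Set ℓ} {S : Vec V k → Set ℓ′} →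
      Def R → Def S → Def (λ xs → R xs → S xs)
    d →ᵈ d′ = def-cong
      (λ xs∈M → mk⇔
        (λ ¬r∧¬s r → def-stable d′ xs∈M λ ¬s → ¬r∧¬s (r , ¬s))
        (λ f (r , ¬s) → ¬s (f r)))
      (def-¬ (d ∧ᵈ def-¬ d′))

    infixr 5 _∨ᵈ_
    _∨ᵈ_ : ∀ {k ℓ ℓ′} {R : Vec V k → Set ℓ} {S : Vec V k → Set ℓ′} →
      Def R → Def S → Def (λ xs → R xs ⊎ S xs)
    _∨ᵈ_ {S = S} d d′ = def-cong
      (λ {xs} xs∈M → mk⇔
        (λ f → byCases d xs∈M inj₁ (inj₂ ∘ f))
        (λ { (inj₁ r) ¬r → ⊥-elim (¬r r) ; (inj₂ s) _ → s }))
      (def-¬ d →ᵈ d′)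
      where
      byCases : ∀ {k ℓ ℓ′} {R : Vec V k → Set ℓ} {A : Set ℓ′} → Def R → ∀ {xs} →
        All (_∈ M) xs → (R xs → A) → (¬ R xs → A) → A
      byCases (def φ as _ h) {xs} xs∈M f g with em {(_∈ M) ⊨ φ [ xs ++ as ]}
      ... | yes s = f (from (h xs∈M) s)
      ... | no ¬s = g (¬s ∘ to (h xs∈M))

    -- `F` rearranges the entries of a tuple and `f` records the position from which each entry is
    -- taken, so that the formula is merely renamed.
    def-subst : ∀ {k l ℓ} {R : Vec V k → Set ℓ} (F : Vec V l → Vec V k) (f : Fin k → Fin l) →
      (∀ xs i → lookup xs (f i) ≡ lookup (F xs) i) → Def R → Def (R ∘ F)
    def-subst {l = l} F f e (def {m} φ as as∈M h) =
      def (reindex (λ i → f i ↑ˡ m) (l ↑ʳ_) φ) as as∈M λ {xs} xs∈M →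
        ⇔-sym (⊨-reindex _ _ φ (F xs) as
          (λ i → trans (lookup-++ˡ xs as (f i)) (e xs i)) (lookup-++ʳ xs as))
        ⇔-∘ h (lookup⁻ λ i → subst (_∈ M) (e xs i) (lookup⁺ xs∈M (f i)))

    -- Under a quantifier over conditions the tuple reads `q ∷ p ∷ σs`; this replaces `p` by the
    -- newly bound `q`.
    def-dropSecond : ∀ {k ℓ} {R : Vec V (suc k) → Set ℓ} → Def R →
      Def {suc (suc k)} (λ xs → R (head xs ∷ tail (tail xs)))
    def-dropSecond = def-subst _ (λ { zero → zero ; (suc i) → suc (suc i) })
      (λ { (_ ∷ _ ∷ _) zero → refl ; (_ ∷ _ ∷ _) (suc i) → refl })

    infixl 9 _at_
    -- The indices are de Bruijn positions: every enclosing `def-∀` or `def-∃` shifts the outer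
    -- variables by one.
    _at_ : ∀ {k l ℓ} {R : Vec V k → Set ℓ} → Def R → (is : Vec (Fin l) k) →
      Def (λ xs → R (map (lookup xs) is))
    d at is = def-subst _ (lookup is) (λ xs i → sym (lookup-map i (lookup xs) is)) d

    -- Elements of `M` may serve as parameters. Freezing the names in a forcing relation thus leaves
    -- a definable class of conditions, to which genericity applies.
    def-specialize : ∀ {k n ℓ} {R : Vec V (k + n) → Set ℓ} (cs : Vec V n) → All (_∈ M) cs →
      Def R → Def (λ (xs : Vec V k) → R (xs ++ cs))
    def-specialize {k} {n} cs cs∈M (def {m} φ as as∈M h) =
      def (reindex ([ _↑ˡ (n + m) , (λ i → k ↑ʳ (i ↑ˡ m)) ]′ ∘ splitAt k)
             (λ i → k ↑ʳ (n ↑ʳ i)) φ)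
        (cs ++ as) (++⁺ cs∈M as∈M) λ {xs} xs∈M →
        ⇔-sym (⊨-reindex _ _ φ (xs ++ cs) as
          (λ i → trans (split xs (splitAt k i)) (sym (lookup-splitAt k xs cs i)))
          (λ i → trans (lookup-++ʳ xs (cs ++ as) (n ↑ʳ i)) (lookup-++ʳ cs as i)))
        ⇔-∘ h (++⁺ xs∈M cs∈M)
      where
      split : ∀ xs s → lookup (xs ++ cs ++ as) ([ _↑ˡ (n + m) , (λ i → k ↑ʳ (i ↑ˡ m)) ]′ s)
                       ≡ [ lookup xs , lookup cs ]′ s
      split xs (inj₁ i) = lookup-++ˡ xs (cs ++ as) i
      split xs (inj₂ j) = trans (lookup-++ʳ xs (cs ++ as) (j ↑ˡ m)) (lookup-++ˡ cs as j)

    def-∈ : Def {2} (λ xs → lookup xs 0F ∈ lookup xs 1F)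
    def-∈ = def (0F ∈′ 1F) [] [] λ { {_ ∷ _ ∷ []} _ → mk⇔ lift lower }

    def-≈ : Def {2} (λ xs → lookup xs 0F ≈ lookup xs 1F)
    def-≈ = def (0F ≐′ 1F) [] [] λ { {_ ∷ _ ∷ []} _ → mk⇔ lift lower }

    -- By transitivity all members of `z` lie in `M`, so a quantifier over `M` inspects the whole of
    -- `z`.
    def-upair : Def {3} (λ xs → lookup xs 0F ≈ ｛ lookup xs 1F , lookup xs 2F ｝)
    def-upair = def-cong
      (λ { {z ∷ x ∷ y ∷ []} (z∈M ∷ _) → mk⇔
        (λ (x∈z , y∈z , only) → ｛,｝-unique {z = z} x∈z y∈z λ {w} w∈z →
          only w (M-transitive {y = z} w∈z z∈M) w∈z)
        (λ e → ∈-respʳ (≈-sym e) ∈｛,｝ˡ , ∈-respʳ (≈-sym e) ∈｛,｝ʳ ,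
               λ _ _ w∈z → ∈｛,｝⁻ (∈-respʳ e w∈z)) })
      (def-∈ at (1F ∷ 0F ∷ []) ∧ᵈ def-∈ at (2F ∷ 0F ∷ []) ∧ᵈ
       def-∀ (def-∈ at (0F ∷ 1F ∷ []) →ᵈ
              def-≈ at (0F ∷ 2F ∷ []) ∨ᵈ def-≈ at (0F ∷ 3F ∷ [])))

    -- The two inner unordered pairs are members of `z`, so transitivity puts them in the range of
    -- the quantifiers.
    def-pair : Def {3} (λ xs → lookup xs 0F ≈ ⟨ lookup xs 1F , lookup xs 2F ⟩)
    def-pair = def-cong
      (λ { {z ∷ x ∷ y ∷ []} (z∈M ∷ _) → mk⇔
        (λ (u , _ , v , _ , eu , ev , ez) → ≈-trans ez (｛,｝-cong eu ev))
        (λ e → _ , M-transitive {y = z} (∈-respʳ (≈-sym e) ∈｛,｝ˡ) z∈M ,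
               _ , M-transitive {y = z} (∈-respʳ (≈-sym e) ∈｛,｝ʳ) z∈M ,
               ≈-refl , ≈-refl , e) })
      (def-∃ (def-∃ (def-upair at (1F ∷ 3F ∷ 3F ∷ []) ∧ᵈ def-upair at (0F ∷ 3F ∷ 4F ∷ []) ∧ᵈ
                     def-upair at (2F ∷ 1F ∷ 0F ∷ []))))

    def-pair∈ : Def {3} (λ xs → ⟨ lookup xs 0F , lookup xs 1F ⟩ ∈ lookup xs 2F)
    def-pair∈ = def-cong
      (λ { {x ∷ y ∷ s ∷ []} (_ ∷ _ ∷ s∈M ∷ []) → mk⇔
        (λ (z , _ , z∈s , e) → ∈-respˡ {y = s} e z∈s)
        (λ h → _ , M-transitive {y = s} h s∈M , h , ≈-refl) })
      (def-∃ (def-∈ at (0F ∷ 3F ∷ []) ∧ᵈ def-pair at (0F ∷ 1F ∷ 2F ∷ [])))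

    pair∈⇒∈M : ∀ {x y s} → s ∈ M → ⟨ x , y ⟩ ∈ s → x ∈ M × y ∈ M
    pair∈⇒∈M {x} {y} {s} s∈M h =
      let p∈M = M-transitive {y = s} h s∈M
      in M-transitive {y = ｛ x , x ｝} ∈｛,｝ˡ (M-transitive {y = ⟨ x , y ⟩} ∈｛,｝ˡ p∈M) ,
         M-transitive {y = ｛ x , y ｝} ∈｛,｝ʳ (M-transitive {y = ⟨ x , y ⟩} ∈｛,｝ʳ p∈M)

    -- Generic filters

    module _ (ℙ : PartialOrder) (ℙ-definable : DefinableOrder M ℙ) where
      open PartialOrder ℙ using (_≤_; Element; rel⊆dom×dom; isPartialOrder)

      def-dom : Def (ElementOf (dom ℙ))
      def-dom = Definable⇒Def (proj₁ ℙ-definable)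

      def-≤ : Def (OrderRelation ℙ)
      def-≤ = Definable⇒Def (proj₂ ℙ-definable)

      dom⊆M : dom ℙ ⊆ M
      dom⊆M {p} p∈ℙ with proj₁ (to (proj₂ (proj₂ (proj₂ (proj₂ (proj₁ ℙ-definable)))) (p ∷ [])) p∈ℙ)
      ... | p∈M ∷ [] = p∈M

      ≤-respʳ : ∀ {p q q′} → q ≈ q′ → p ≤ q → p ≤ q′
      ≤-respʳ e = ∈-respˡ {y = rel ℙ} (⟨,⟩-cong ≈-refl e)

      ≤⇒∈ : ∀ {p q} → p ≤ q → p ∈ dom ℙ × q ∈ dom ℙ
      ≤⇒∈ p≤q = let (_ , _ , p∈ℙ , q∈ℙ , e) = rel⊆dom×dom p≤q
                in ∈-respˡ {y = dom ℙ} (≈-sym (⟨,⟩-injectiveˡ e)) p∈ℙ ,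
                   ∈-respˡ {y = dom ℙ} (≈-sym (⟨,⟩-injectiveʳ e)) q∈ℙ

      ≤⇒∈M : ∀ {p q} → p ≤ q → p ∈ M
      ≤⇒∈M p≤q = dom⊆M (proj₁ (≤⇒∈ p≤q))

      ≤-refl : ∀ {p} → p ∈ dom ℙ → p ≤ p
      ≤-refl {p} p∈ℙ = IsPartialOrder.refl isPartialOrder {p , p∈ℙ}

      ≤-trans : ∀ {p q r} → p ≤ q → q ≤ r → p ≤ r
      ≤-trans {p} {q} {r} p≤q q≤r =
        IsPartialOrder.trans isPartialOrder
          {p , proj₁ (≤⇒∈ p≤q)} {q , proj₁ (≤⇒∈ q≤r)} {r , proj₂ (≤⇒∈ q≤r)} p≤q q≤r

      module _ (M-countable : Countable M) where

        private
          enum : ℕ → V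
          enum k = M ! proj₁ M-countable k

        codeParameters : ∀ {m} (as : Vec V m) → All (_∈ M) as →
          Σ[ ks ∈ Vec ℕ m ] Pointwise _≈_ as (map enum ks)
        codeParameters []       []                    = [] , []
        codeParameters (a ∷ as) ((i , a≈Mi) ∷ as∈M) =
          let (k , e) = proj₂ M-countable i
              (ks , es) = codeParameters as as∈M
          in k ∷ ks , ≈-trans a≈Mi (≈-sym e) ∷ es

        Holds : Code → V → Set₁
        Holds (_ , φ , ks) q = (_∈ M) ⊨ φ [ q ∷ map enum ks ]

        -- The test is whether this one condition has a suitable extension, not whether the code is
        -- dense; the default is to stay at `p`, which keeps the step total.
        refine : Code → Element → Element
        refine c (p , p∈ℙ) with em {∃[ q ] q ∈ dom ℙ × q ≤ p × Holds c q}
        ... | yes (q , q∈ℙ , _) = q , q∈ℙ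
        ... | no _              = p , p∈ℙ

        refine-≤ : ∀ c x → proj₁ (refine c x) ≤ proj₁ x
        refine-≤ c (p , p∈ℙ) with em {∃[ q ] q ∈ dom ℙ × q ≤ p × Holds c q}
        ... | yes (_ , _ , q≤p , _) = q≤p
        ... | no _                  = ≤-refl p∈ℙ

        DenseCode : Code → Set₁
        DenseCode c = ∀ {p} → p ∈ dom ℙ → ∃[ q ] q ∈ dom ℙ × q ≤ p × Holds c q

        refine-holds : ∀ c x → DenseCode c → Holds c (proj₁ (refine c x))
        refine-holds c (p , p∈ℙ) dense with em {∃[ q ] q ∈ dom ℙ × q ≤ p × Holds c q}
        ... | yes (_ , _ , _ , h) = h
        ... | no ¬∃               = ⊥-elim (¬∃ (dense p∈ℙ))

        refineAll : List Code → Element → Element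
        refineAll []       x = x
        refineAll (c ∷ cs) x = refine c (refineAll cs x)

        refineAll-≤ : ∀ cs x → proj₁ (refineAll cs x) ≤ proj₁ x
        refineAll-≤ []       x = ≤-refl (proj₂ x)
        refineAll-≤ (c ∷ cs) x = ≤-trans (refine-≤ c (refineAll cs x)) (refineAll-≤ cs x)

        -- The extension chosen when the list reaches `c` stays above the final condition, since the
        -- remaining refinements only descend.
        refineAll-meets : ∀ {c cs} x → c ∈ˡ cs → DenseCode c →
          ∃[ q ] q ∈ dom ℙ × proj₁ (refineAll cs x) ≤ q × Holds c q
        refineAll-meets {c} {_ ∷ cs} x (here refl) dense =
          let y = refine c (refineAll cs x)
          in proj₁ y , proj₂ y , ≤-refl (proj₂ y) , refine-holds c (refineAll cs x) dense
        refineAll-meets {_} {c ∷ cs} x (there c∈cs) dense =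
          let (q , q∈ℙ , le , h) = refineAll-meets x c∈cs dense
          in q , q∈ℙ , ≤-trans (refine-≤ c (refineAll cs x)) le , h

        module _ (x₀ : Element) where

          chain : ℕ → Element
          chain zero    = x₀
          chain (suc n) = refineAll (codesBelow n) (chain n)

          chain-antitone : ∀ {m n} → m ≤′ n → proj₁ (chain n) ≤ proj₁ (chain m)
          chain-antitone {m} ≤′-refl = ≤-refl (proj₂ (chain m))
          chain-antitone {n = suc n} (≤′-step m≤n) =
            ≤-trans (refineAll-≤ (codesBelow n) (chain n)) (chain-antitone m≤n)

          -- The upward closure of the chain, carved out of the index type of `dom ℙ` so that it is
          -- an element of `V`.
          chainFilter : V
          chainFilter = sup (Σ[ i ∈ Index (dom ℙ) ] ∃[ n ] proj₁ (chain n) ≤ dom ℙ ! i)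
                            (λ (i , _) → dom ℙ ! i)

          ∈-chainFilter : ∀ {q} → q ∈ chainFilter ⇔ (q ∈ dom ℙ × ∃[ n ] proj₁ (chain n) ≤ q)
          ∈-chainFilter = mk⇔
            (λ ((i , n , le) , e) → (i , e) , n , ≤-respʳ (≈-sym e) le)
            (λ ((i , e) , n , le) → (i , n , ≤-respʳ e le) , e)

          -- The Rasiowa-Sikorski argument: a definable dense set has a code `c`, which is treated
          -- in passing from stage `rank c` to the next. Two members of the filter lie above two
          -- stages of the chain, and the later stage lies below both.
          chainFilter-generic : IsGeneric M ℙ chainFilter
          chainFilter-generic = record
            { isFilter = record
              { subset   = proj₁ ∘ to ∈-chainFilter
              ; nonempty = proj₁ x₀ , from ∈-chainFilter (proj₂ x₀ , 0 , ≤-refl (proj₂ x₀))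
              ; upward   = λ p∈G q∈ℙ p≤q →
                  let (_ , n , le) = to ∈-chainFilter p∈G
                  in from ∈-chainFilter (q∈ℙ , n , ≤-trans le p≤q)
              ; directed = λ p∈G q∈G →
                  let (_ , m , le)  = to ∈-chainFilter p∈G
                      (_ , n , le′) = to ∈-chainFilter q∈G
                      r = chain (m ⊔ⁿ n)
                  in proj₁ r , from ∈-chainFilter (proj₂ r , m ⊔ⁿ n , ≤-refl (proj₂ r)) ,
                     ≤-trans (chain-antitone (≤⇒≤′ (m≤m⊔n m n))) le ,
                     ≤-trans (chain-antitone (≤⇒≤′ (m≤n⊔m m n))) le′
              }
            ; meets = λ D D-dense (m , φ , as , as∈M , h) →
                -- The given parameters are only bisimilar to enumerated ones, so satisfaction is
                -- transported along `es`, in one direction for density and in the other for the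
                -- condition found.
                let (ks , es) = codeParameters as as∈M
                    c = m , φ , ks
                    (q , q∈ℙ , le , s) =
                      refineAll-meets (chain (rank c)) (∈-codesBelow c) λ p∈ℙ →
                        let (q , q∈D , q≤p) = IsDense.dense D-dense p∈ℙ
                        in q , IsDense.subset D-dense q∈D , q≤p ,
                           ⊨-resp φ (≈-refl ∷ es) (proj₂ (to (h (q ∷ [])) q∈D))
                in q , from ∈-chainFilter (q∈ℙ , suc (rank c) , le) ,
                   from (h (q ∷ []))
                     (dom⊆M q∈ℙ ∷ [] , ⊨-resp φ (≈-refl ∷ Pointwise.sym ≈-sym es) s)
            }

        generic-exists : ∀ {p} → p ∈ dom ℙ → ∃[ G ] IsGeneric M ℙ G × p ∈ G
        generic-exists {p} p∈ℙ = chainFilter (p , p∈ℙ) , chainFilter-generic (p , p∈ℙ) ,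
          from (∈-chainFilter (p , p∈ℙ)) (p∈ℙ , 0 , ≤-refl p∈ℙ)

      -- Genericity speaks of elements of `V`, whose index types are small, whereas satisfaction
      -- lives in `Set₁`. Excluded middle closes the gap: `True` of a decision is small.
      comprehension : ∀ {ℓ} {A : Vec V 1 → Set ℓ} → Def A →
        ∃[ D ] DefinableSet M D × (∀ {z} → z ∈ D ⇔ (z ∈ dom ℙ × A (z ∷ [])))
      comprehension {A = A} d = D , Def⇒Definable D⊆M (def-cong spec′ d′) , spec
        where
        d′ : Def (λ xs → ElementOf (dom ℙ) xs × A xs)
        d′ = def-dom ∧ᵈ d
        open Def d′
        D : V
        D = sup (Σ[ i ∈ Index (dom ℙ) ] True (em {(_∈ M) ⊨ formula [ dom ℙ ! i ∷ parameters ]}))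
                (λ (i , _) → dom ℙ ! i)
        i∈M : ∀ i → All (_∈ M) (dom ℙ ! i ∷ [])
        i∈M i = dom⊆M (!-∈ (dom ℙ) i) ∷ []
        spec : ∀ {z} → z ∈ D ⇔ (z ∈ dom ℙ × A (z ∷ []))
        spec = mk⇔
          (λ ((i , t) , e) →
            def-resp d′ (i∈M i) (dom⊆M (i , e) ∷ []) (≈-sym e ∷ [])
              (from (defines (i∈M i)) (toWitness t)))
          (λ ((i , e) , a) →
            (i , fromWitness (to (defines (i∈M i))
              (def-resp d′ (dom⊆M (i , e) ∷ []) (i∈M i) (e ∷ []) ((i , e) , a)))) , e)
        D⊆M : ∀ {xs} → ElementOf D xs → All (_∈ M) xs
        D⊆M {_ ∷ []} z∈D = dom⊆M (proj₁ (to spec z∈D)) ∷ []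
        spec′ : ∀ {xs} → All (_∈ M) xs → (ElementOf (dom ℙ) xs × A xs) ⇔ ElementOf D xs
        spec′ {_ ∷ []} _ = ⇔-sym spec

      module _ {G : V} (G-generic : IsGeneric M ℙ G) where
        open IsGeneric G-generic
        open IsFilter isFilter

        filter-upward : ∀ {p q} → p ≤ q → p ∈ G → q ∈ G
        filter-upward p≤q p∈G = upward p∈G (proj₂ (≤⇒∈ p≤q)) p≤q

        generic-meets : ∀ {ℓ} {A : Vec V 1 → Set ℓ} → Def A →
          (∀ {p} → p ∈ dom ℙ → ∃[ q ] q ≤ p × A (q ∷ [])) → ∃[ q ] q ∈ G × A (q ∷ [])
        generic-meets d dense =
          let (D , D-definable , spec) = comprehension d
              (q , q∈G , q∈D) = meets D
                (record
                  { subset = proj₁ ∘ to spec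
                  ; dense  = λ p∈ℙ → let (q , q≤p , a) = dense p∈ℙ
                                     in q , from spec (proj₁ (≤⇒∈ q≤p) , a) , q≤p })
                D-definable
          in q , q∈G , proj₂ (to spec q∈D)

        -- The conditions that satisfy `A` or are incompatible with `p` form a dense definable
        -- class. A member of `G` cannot be incompatible with `p ∈ G`, as the filter is directed.
        generic-meets-below : ∀ {p} {A : Vec V 1 → Set₁} → p ∈ G → Def A →
          (∀ {s} → s ≤ p → ∃[ q ] q ≤ s × A (q ∷ [])) → ∃[ q ] q ∈ G × A (q ∷ [])
        generic-meets-below {p} {A} p∈G d dense =
          let (q , q∈G , cases) = generic-meets
                (d ∨ᵈ def-specialize (p ∷ []) (dom⊆M (subset p∈G) ∷ []) def-⊥) λ {s} s∈ℙ →
                  denseOrIncompatible s∈ℙ (em {∃[ t ] t ≤ s × t ≤ p})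
          in q , q∈G , [ id , (λ ⊥p → let (r , _ , r≤q , r≤p) = directed q∈G p∈G
                                      in ⊥-elim (⊥p r (≤⇒∈M r≤q) r≤q r≤p)) ]′ cases
          where
          Incompatible : Vec V 2 → Set₁
          Incompatible xs = ∀ r → r ∈ M → r ≤ lookup xs 0F → ¬ r ≤ lookup xs 1F
          def-⊥ : Def Incompatible
          def-⊥ = def-∀ (def-≤ at (0F ∷ 1F ∷ []) →ᵈ def-¬ (def-≤ at (0F ∷ 2F ∷ [])))
          denseOrIncompatible : ∀ {s} → s ∈ dom ℙ → Dec (∃[ t ] t ≤ s × t ≤ p) →
            ∃[ q ] q ≤ s × (A (q ∷ []) ⊎ Incompatible (q ∷ p ∷ []))
          denseOrIncompatible s∈ℙ (yes (t , t≤s , t≤p)) =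
            let (q , q≤t , a) = dense t≤p in q , ≤-trans q≤t t≤s , inj₁ a
          denseOrIncompatible {s} s∈ℙ (no ¬∃) =
            s , ≤-refl s∈ℙ , inj₂ λ r _ r≤s r≤p → ¬∃ (r , r≤s , r≤p)

      -- Forcing relations

      Forcing : ∀ {n} → Formula n → Vec V (suc n) → Set₁
      Forcing = ForcingRelation M ℙ

      forcing⊆M : ∀ {n} (φ : Formula n) {xs} → Forcing φ xs → All (_∈ M) xs
      forcing⊆M φ {_ ∷ _} (p∈ℙ , ns , _) = dom⊆M p∈ℙ ∷ All.map proj₁ ns

      forces-mono : ∀ {n p q} (φ : Formula n) σs → q ≤ p → Forces M ℙ p φ σs → Forces M ℙ q φ σs
      forces-mono φ σs q≤p f G G-generic q∈G =
        f G G-generic (filter-upward G-generic q≤p q∈G)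

      -- The recursive clause for forcing `¬′ φ`. The guard `q ∈ M` gives the quantifier the form
      -- that `def-∀` handles.
      Refuted : ∀ {n} → Formula n → Vec V (suc n) → Set₁
      Refuted φ (p ∷ σs) = ∀ q → q ∈ M → q ≤ p → ¬ Forcing φ (q ∷ σs)

      def-refuted : ∀ {n} {φ : Formula n} → DefinabilityLemma M ℙ φ → Def (Refuted φ)
      def-refuted D = def-cong
        (λ { {p ∷ σs} _ → ⇔-id _ })
        (def-∀ (def-≤ at (0F ∷ 1F ∷ []) →ᵈ def-¬ (def-dropSecond (Definable⇒Def D))))

      -- If `φ` held in `M[G]`, the truth lemma would give some `q ∈ G` forcing it, and a common
      -- extension of `p` and `q` would force `φ` below `p`.
      refuted⇒false : ∀ {n p σs} (φ : Formula n) → TruthLemma M ℙ φ → All (M ^ ℙ) σs →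
        Refuted φ (p ∷ σs) → ∀ {G} → IsGeneric M ℙ G → p ∈ G →
        ¬ (M [ G ]^ ℙ ⊨ φ [ map (val G) σs ])
      refuted⇒false {σs = σs} φ T ns r {G} G-generic p∈G sat =
        let (q , q∈G , q⊩φ) = T σs ns G G-generic sat
            (t , t∈G , t≤p , t≤q) = IsFilter.directed (IsGeneric.isFilter G-generic) p∈G q∈G
        in r t (≤⇒∈M t≤p) t≤p (proj₁ (≤⇒∈ t≤p) , ns , forces-mono φ σs t≤q q⊩φ)

      -- The conditions forcing `φ` form a definable class, so a generic filter through `p` meets
      -- it.
      forces-dense : ∀ {n p σs} (φ : Formula n) → DefinabilityLemma M ℙ φ → All (M ^ ℙ) σs →
        (∀ {s} → s ≤ p → ∃[ q ] q ≤ s × Forcing φ (q ∷ σs)) → Forces M ℙ p φ σs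
      forces-dense {σs = σs} φ D ns dense G G-generic p∈G =
        let (q , q∈G , (_ , _ , q⊩φ)) = generic-meets-below G-generic p∈G
              (def-specialize σs (All.map proj₁ ns) (Definable⇒Def D)) dense
        in q⊩φ G G-generic q∈G

      -- Otherwise every `s ≤ p` would have an extension forcing `φ`, and `forces-dense` would make
      -- `p` force it.
      ¬forces⇒refuted-below : ∀ {n p σs} (φ : Formula n) → DefinabilityLemma M ℙ φ →
        All (M ^ ℙ) σs → ¬ Forces M ℙ p φ σs → ∃[ q ] q ≤ p × Refuted φ (q ∷ σs)
      ¬forces⇒refuted-below φ D ns p⊮φ = byContradiction λ ¬refuted →
        p⊮φ (forces-dense φ D ns λ {s} s≤p → byContradiction λ ¬∃ →
          ¬refuted (s , s≤p , λ q _ q≤s q⊩φ → ¬∃ (q , q≤s , q⊩φ)))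

      -- Names come paired with a condition because their definability is read off from a forcing
      -- relation, whose tuples begin with one.
      NameAt : Vec V 2 → Set₁
      NameAt xs = lookup xs 0F ∈ dom ℙ × (M ^ ℙ) (lookup xs 1F)

      component : ∀ {σ π r} → (M ^ ℙ) σ → ⟨ π , r ⟩ ∈ σ → (M ^ ℙ) π × r ∈ dom ℙ
      component {σ} (σ∈M , nσ) h =
        let (nπ , r∈ℙ) = IsName-component nσ h in (proj₁ (pair∈⇒∈M {s = σ} σ∈M h) , nπ) , r∈ℙ

      -- Equality from membership

      module _ (zf : ZF⁻ M) (D∈ : DefinabilityLemma M ℙ v₀∈v₁) where

        private
          def-⊩∈ : Def (Forcing v₀∈v₁)
          def-⊩∈ = Definable⇒Def D∈

        upair∈M : ∀ {x y} → x ∈ M → y ∈ M → ｛ x , y ｝ ∈ M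
        upair∈M {x} {y} x∈M y∈M =
          let (u , u∈M , h) = ZF⁻.pairing zf x y x∈M y∈M
          in ∈-respˡ {y = M} (｛,｝-unique {z = u} (from (h x x∈M) (inj₁ ≈-refl))
               (from (h y y∈M) (inj₂ ≈-refl))
               (λ {w} w∈u → to (h w (M-transitive {y = u} w∈u u∈M)) w∈u)) u∈M

        -- Every p ∈ ℙ forces σ ∈ {⟨σ, p⟩}.
        def-NameAt-from-∈ : Def NameAt
        def-NameAt-from-∈ = def-cong
          (λ { {p ∷ σ ∷ []} (p∈M ∷ σ∈M ∷ []) → mk⇔
            (λ { (_ , _ , p∈ℙ , nσ ∷ _ , _) → p∈ℙ , nσ })
            (λ (p∈ℙ , nσ) →
              let τ = ｛ ⟨ σ , p ⟩ , ⟨ σ , p ⟩ ｝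
                  q∈M = upair∈M (upair∈M σ∈M σ∈M) (upair∈M σ∈M p∈M)
                  τ∈M = upair∈M q∈M q∈M
              in τ , τ∈M , p∈ℙ ,
                 nσ ∷ (τ∈M , name λ z∈τ → σ , p , ∈-singleton z∈τ , proj₂ nσ , p∈ℙ) ∷ [] ,
                 λ G _ p∈G → lift (∈-val⁺ G τ ∈｛,｝ˡ p∈G)) })
          (def-∃ (def-⊩∈ at (1F ∷ 2F ∷ 0F ∷ [])))

        ForcesSubset : Vec V 3 → Set₁
        ForcesSubset xs = ∀ π → π ∈ M → ∀ r → r ∈ M → ∀ q → q ∈ M →
          ⟨ π , r ⟩ ∈ lookup xs 1F → q ≤ lookup xs 0F → q ≤ r →
          Forcing v₀∈v₁ (q ∷ π ∷ lookup xs 2F ∷ [])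

        def-ForcesSubset : Def ForcesSubset
        def-ForcesSubset = def-∀ (def-∀ (def-∀
          (def-pair∈ at (2F ∷ 1F ∷ 4F ∷ []) →ᵈ def-≤ at (0F ∷ 3F ∷ []) →ᵈ
           def-≤ at (0F ∷ 1F ∷ []) →ᵈ def-⊩∈ at (0F ∷ 2F ∷ 5F ∷ []))))

        forcesSubset⁺ : ∀ {p σ τ} → (M ^ ℙ) σ → (M ^ ℙ) τ →
          (∀ {G} → IsGeneric M ℙ G → p ∈ G → val G σ ≈ val G τ) →
          ForcesSubset (p ∷ σ ∷ τ ∷ [])
        forcesSubset⁺ {σ = σ} nσ nτ h π _ r _ q _ πr∈σ q≤p q≤r =
          let (nπ , r∈ℙ) = component nσ πr∈σ
          in proj₁ (≤⇒∈ q≤p) , nπ ∷ nτ ∷ [] , λ G G-generic q∈G →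
             lift (∈-respʳ (h G-generic (filter-upward G-generic q≤p q∈G))
                    (∈-val⁺ G σ πr∈σ (filter-upward G-generic q≤r q∈G)))

        -- A member of `val G σ` comes from some `⟨ π , r ⟩` with `r ∈ G`; a common extension of `p`
        -- and `r` in `G` forces `π ∈ τ`.
        forcesSubset⁻ : ∀ {p σ τ} → (M ^ ℙ) σ → ForcesSubset (p ∷ σ ∷ τ ∷ []) →
          ∀ {G} → IsGeneric M ℙ G → p ∈ G → val G σ ⊆ val G τ
        forcesSubset⁻ {σ = σ} {τ} nσ h {G} G-generic p∈G = val-⊆ G σ τ λ {π} {r} πr∈σ r∈G →
          let (q , q∈G , q≤p , q≤r) = IsFilter.directed (IsGeneric.isFilter G-generic) p∈G r∈G
              (π∈M , r∈M) = pair∈⇒∈M {s = σ} (proj₁ nσ) πr∈σ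
          in lower (proj₂ (proj₂ (h π π∈M r r∈M q (≤⇒∈M q≤p) πr∈σ q≤p q≤r)) G G-generic q∈G)

        definability-≐-from-∈ : DefinabilityLemma M ℙ v₀≐v₁
        definability-≐-from-∈ = Def⇒Definable (forcing⊆M v₀≐v₁) (def-cong
          (λ { {p ∷ σ ∷ τ ∷ []} _ → mk⇔
            (λ ((p∈ℙ , nσ) , (_ , nτ) , σ⊆τ , τ⊆σ) →
              p∈ℙ , nσ ∷ nτ ∷ [] , λ G G-generic p∈G →
                lift (⊆-antisym (forcesSubset⁻ {τ = τ} nσ σ⊆τ G-generic p∈G)
                                (forcesSubset⁻ {τ = σ} nτ τ⊆σ G-generic p∈G)))
            (λ { (p∈ℙ , nσ ∷ nτ ∷ [] , f) → (p∈ℙ , nσ) , (p∈ℙ , nτ) ,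
              forcesSubset⁺ nσ nτ (λ G-generic p∈G → lower (f _ G-generic p∈G)) ,
              forcesSubset⁺ nτ nσ (λ G-generic p∈G → ≈-sym (lower (f _ G-generic p∈G))) }) })
          (def-NameAt-from-∈ at (0F ∷ 1F ∷ []) ∧ᵈ def-NameAt-from-∈ at (0F ∷ 2F ∷ []) ∧ᵈ
           def-ForcesSubset ∧ᵈ def-ForcesSubset at (0F ∷ 2F ∷ 1F ∷ [])))

      -- Atomic formulae from definable forcing of equality

      module _ (M-countable : Countable M) (D≐ : DefinabilityLemma M ℙ v₀≐v₁) where

        private
          def-⊩≐ : Def (Forcing v₀≐v₁)
          def-⊩≐ = Definable⇒Def D≐

        -- The names are the σ with p ⊩ σ = σ, so the recursion defining names need
        -- not be carried out in M.
        def-NameAt : Def NameAt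
        def-NameAt = def-cong
          (λ { {p ∷ σ ∷ []} _ → mk⇔
            (λ { (p∈ℙ , nσ ∷ _ , _) → p∈ℙ , nσ })
            (λ (p∈ℙ , nσ) → p∈ℙ , nσ ∷ nσ ∷ [] , λ _ _ _ → lift ≈-refl) })
          (def-⊩≐ at (0F ∷ 1F ∷ 1F ∷ []))

        def-names : ∀ n → Def {suc n} (λ xs → head xs ∈ dom ℙ × All (M ^ ℙ) (tail xs))
        def-names zero = def-cong
          (λ { {_ ∷ []} _ → mk⇔ (_, []) proj₁ })
          (def-dom at (0F ∷ []))
        def-names (suc n) = def-cong
          (λ { {_ ∷ _ ∷ _} _ → mk⇔
            (λ ((p∈ℙ , nσ) , _ , ns) → p∈ℙ , nσ ∷ ns)
            (λ { (p∈ℙ , nσ ∷ ns) → (p∈ℙ , nσ) , p∈ℙ , ns }) })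
          (def-NameAt at (0F ∷ 1F ∷ []) ∧ᵈ
           def-dropSecond (def-names n))

        -- A strong form of forcing `π ∈ τ`, in which the condition already settles which component
        -- `ρ` of `τ` equals `π`.
        Witnessed : Vec V 3 → Set₁
        Witnessed xs = ∃[ ρ ] ρ ∈ M × ∃[ r ] r ∈ M × ⟨ ρ , r ⟩ ∈ lookup xs 2F ×
          lookup xs 0F ≤ r × Forcing v₀≐v₁ (lookup xs 0F ∷ lookup xs 1F ∷ ρ ∷ [])

        def-Witnessed : Def Witnessed
        def-Witnessed = def-∃ (def-∃
          (def-pair∈ at (1F ∷ 0F ∷ 4F ∷ []) ∧ᵈ def-≤ at (2F ∷ 0F ∷ []) ∧ᵈ
           def-⊩≐ at (2F ∷ 3F ∷ 1F ∷ [])))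

        witnessed⇒val∈ : ∀ {p π τ G} → Witnessed (p ∷ π ∷ τ ∷ []) → IsGeneric M ℙ G → p ∈ G →
          val G π ∈ val G τ
        witnessed⇒val∈ {τ = τ} {G} (ρ , _ , r , _ , ρr∈τ , p≤r , _ , _ , f) G-generic p∈G =
          ∈-respˡ {y = val G τ} (≈-sym (lower (f G G-generic p∈G)))
            (∈-val⁺ G τ ρr∈τ (filter-upward G-generic p≤r p∈G))

        witnessed-dense : ∀ {p π τ G} → π ∈ M → τ ∈ M → IsGeneric M ℙ G → p ∈ G →
          (∀ {s} → s ≤ p → ∃[ q ] q ≤ s × Witnessed (q ∷ π ∷ τ ∷ [])) → val G π ∈ val G τ
        witnessed-dense {p} {π} {τ} π∈M τ∈M G-generic p∈G dense =
          let (q , q∈G , w) = generic-meets-below G-generic p∈G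
                (def-specialize (π ∷ τ ∷ []) (π∈M ∷ τ∈M ∷ []) def-Witnessed) dense
          in witnessed⇒val∈ {τ = τ} w G-generic q∈G

        -- The truth lemma for equality at a single pair of names, isolated to serve as induction
        -- hypothesis.
        ≐-truth-at : V → V → Set₁
        ≐-truth-at σ τ = ∀ {G} → IsGeneric M ℙ G → val G σ ≈ val G τ →
          ∃[ p ] p ∈ G × Forces M ℙ p v₀≐v₁ (σ ∷ τ ∷ [])

        -- Membership gives `⟨ ρ , r ⟩` in `τ` with `r ∈ G` and equal values of `π` and `ρ`; the
        -- truth lemma for this pair gives `s ∈ G` forcing the equality. Any common extension of `s`
        -- and `r` is a witness, and extending `q` as well places it below a prescribed condition.
        val∈⇒witnessed : ∀ {G q π τ} → IsGeneric M ℙ G → q ∈ G → (M ^ ℙ) π → (M ^ ℙ) τ →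
          (∀ {ρ} → ρ ⊏ τ → (M ^ ℙ) ρ → ≐-truth-at π ρ) → val G π ∈ val G τ →
          ∃[ t ] t ∈ G × t ≤ q × Witnessed (t ∷ π ∷ τ ∷ [])
        val∈⇒witnessed {G} {q} {π} {τ} G-generic q∈G nπ nτ truth π∈τ =
          let open IsFilter (IsGeneric.isFilter G-generic)
              (ρ , r , r∈G , ρr∈τ , e) = to (∈-val G τ (val G π)) π∈τ
              (nρ , _) = component nτ ρr∈τ
              (s , s∈G , s⊩) = truth (r , ρr∈τ) nρ G-generic e
              (t , t∈G , t≤s , t≤r) = directed s∈G r∈G
              (u , u∈G , u≤t , u≤q) = directed t∈G q∈G
          in u , u∈G , u≤q , ρ , proj₁ nρ , r , proj₂ (pair∈⇒∈M {s = τ} (proj₁ nτ) ρr∈τ) ,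
             ρr∈τ , ≤-trans u≤t t≤r , proj₁ (≤⇒∈ u≤q) , nπ ∷ nρ ∷ [] ,
             forces-mono v₀≐v₁ (π ∷ ρ ∷ []) (≤-trans u≤t t≤s) s⊩

        -- A strong form of forcing that `σ` is not a subset of `τ`: the condition puts a fixed `π`
        -- into `σ` and excludes every witness for `π ∈ τ` below it.
        NotSubset : Vec V 3 → Set₁
        NotSubset xs = ∃[ π ] π ∈ M × ∃[ r ] r ∈ M × ⟨ π , r ⟩ ∈ lookup xs 1F ×
          lookup xs 0F ≤ r ×
          (∀ q → q ∈ M → q ≤ lookup xs 0F → ¬ Witnessed (q ∷ π ∷ lookup xs 2F ∷ []))

        def-NotSubset : Def NotSubset
        def-NotSubset = def-∃ (def-∃
          (def-pair∈ at (1F ∷ 0F ∷ 3F ∷ []) ∧ᵈ def-≤ at (2F ∷ 0F ∷ []) ∧ᵈ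
           def-∀ (def-≤ at (0F ∷ 3F ∷ []) →ᵈ def-¬ (def-Witnessed at (0F ∷ 2F ∷ 5F ∷ [])))))

        -- For `⟨ π , r ⟩` in `σ` with `r ∈ G`, take `q ∈ G` below `p` and `r`. Witnesses for
        -- `π ∈ τ` are dense below `q`, since an `s ≤ q` with none below it would be a case of
        -- `NotSubset`.
        notSubset-dense : ∀ {p σ τ G} → (M ^ ℙ) σ → (M ^ ℙ) τ →
          ¬ (∃[ q ] q ≤ p × NotSubset (q ∷ σ ∷ τ ∷ [])) →
          IsGeneric M ℙ G → p ∈ G → val G σ ⊆ val G τ
        notSubset-dense {p} {σ} {τ} {G} nσ nτ ¬∃ G-generic p∈G =
          val-⊆ G σ τ λ {π} {r} πr∈σ r∈G →
            let (q , q∈G , q≤p , q≤r) = IsFilter.directed (IsGeneric.isFilter G-generic) p∈G r∈G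
                (π∈M , r∈M) = pair∈⇒∈M {s = σ} (proj₁ nσ) πr∈σ
            in witnessed-dense {τ = τ} π∈M (proj₁ nτ) G-generic q∈G λ {s} s≤q →
                 byContradiction λ ¬w → ¬∃ (s , ≤-trans s≤q q≤p , π , π∈M , r , r∈M , πr∈σ ,
                   ≤-trans s≤q q≤r , λ t _ t≤s w → ¬w (t , t≤s , w))

        notSubset⇒val⊈ : ∀ {p σ τ G} → (M ^ ℙ) σ → (M ^ ℙ) τ →
          (∀ {π ρ} → π ⊏ σ → ρ ⊏ τ → (M ^ ℙ) π → (M ^ ℙ) ρ → ≐-truth-at π ρ) →
          NotSubset (p ∷ σ ∷ τ ∷ []) → IsGeneric M ℙ G → p ∈ G → ¬ val G σ ⊆ val G τ
        notSubset⇒val⊈ {σ = σ} {τ} {G} nσ nτ truth (π , _ , r , _ , πr∈σ , p≤r , ¬w) G-generic p∈G σ⊆τ =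
          let (nπ , _) = component nσ πr∈σ
              (t , _ , t≤p , w) = val∈⇒witnessed {τ = τ} G-generic p∈G nπ nτ
                (λ ρ⊏τ nρ → truth (r , πr∈σ) ρ⊏τ nπ nρ)
                (σ⊆τ (∈-val⁺ G σ πr∈σ (filter-upward G-generic p≤r p∈G)))
          in ¬w t (≤⇒∈M t≤p) t≤p w

        -- Induction on the first name alone suffices, because the second stays arbitrary. The class
        -- `Cases` is dense, and for a member of `G` the equality of the values rules out both
        -- `NotSubset` cases.
        ≐-truth : ∀ {σ τ} → Acc _⊏_ σ → (M ^ ℙ) σ → (M ^ ℙ) τ → ≐-truth-at σ τ
        ≐-truth {σ} {τ} (acc rs) nσ nτ {G} G-generic e =
          let (p , p∈G , cases) = generic-meets G-generic
                (def-specialize (σ ∷ τ ∷ []) (proj₁ nσ ∷ proj₁ nτ ∷ [])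
                  (def-⊩≐ ∨ᵈ def-NotSubset ∨ᵈ def-NotSubset at (0F ∷ 2F ∷ 1F ∷ [])))
                dense
          in p , p∈G , decide p∈G cases
          where
          Cases : V → Set₁
          Cases p = Forcing v₀≐v₁ (p ∷ σ ∷ τ ∷ []) ⊎
                    NotSubset (p ∷ σ ∷ τ ∷ []) ⊎ NotSubset (p ∷ τ ∷ σ ∷ [])

          -- A condition with no extension in either `NotSubset` case forces both inclusions, and so
          -- falls under the first case itself.
          dense : ∀ {p} → p ∈ dom ℙ → ∃[ q ] q ≤ p × Cases q
          dense {p} p∈ℙ = byContradiction λ ¬∃ → ¬∃ (p , ≤-refl p∈ℙ , inj₁
            (p∈ℙ , nσ ∷ nτ ∷ [] , λ H H-generic p∈H → lift (⊆-antisym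
              (notSubset-dense {σ = σ} {τ} nσ nτ (λ (q , q≤p , n) → ¬∃ (q , q≤p , inj₂ (inj₁ n)))
                H-generic p∈H)
              (notSubset-dense {σ = τ} {σ} nτ nσ (λ (q , q≤p , n) → ¬∃ (q , q≤p , inj₂ (inj₂ n)))
                H-generic p∈H))))

          decide : ∀ {p} → p ∈ G → Cases p → Forces M ℙ p v₀≐v₁ (σ ∷ τ ∷ [])
          decide p∈G (inj₁ (_ , _ , p⊩)) = p⊩
          decide p∈G (inj₂ (inj₁ n)) = ⊥-elim
            (notSubset⇒val⊈ {τ = τ} nσ nτ (λ π⊏σ _ nπ nρ → ≐-truth (rs π⊏σ) nπ nρ)
              n G-generic p∈G (∈-respʳ e))
          decide p∈G (inj₂ (inj₂ n)) = ⊥-elim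
            (notSubset⇒val⊈ {τ = σ} nτ nσ
              -- With the names exchanged, the component of `σ` comes second. The induction
              -- hypothesis is therefore used for the reversed pair, and the symmetry of equality
              -- turns its result around.
              (λ _ ρ⊏σ nπ nρ H-generic e′ →
                let (p , p∈H , p⊩) = ≐-truth (rs ρ⊏σ) nρ nπ H-generic (≈-sym e′)
                in p , p∈H , λ H H-generic p∈H → lift (≈-sym (lower (p⊩ H H-generic p∈H))))
              n G-generic p∈G (∈-respʳ (≈-sym e)))

        forcing-theorem-≐ : ForcingTheorem M ℙ v₀≐v₁
        forcing-theorem-≐ = D≐ , λ { (σ ∷ τ ∷ []) (nσ ∷ nτ ∷ []) G G-generic (lift e) →
          ≐-truth (⊏-wellFounded σ) nσ nτ G-generic e }

        WitnessedDensely : Vec V 3 → Set₁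
        WitnessedDensely xs = ∀ s → s ∈ M → s ≤ lookup xs 0F →
          ∃[ q ] q ∈ M × q ≤ s × Witnessed (q ∷ lookup xs 1F ∷ lookup xs 2F ∷ [])

        def-WitnessedDensely : Def WitnessedDensely
        def-WitnessedDensely = def-∀ (def-≤ at (0F ∷ 1F ∷ []) →ᵈ
          def-∃ (def-≤ at (0F ∷ 1F ∷ []) ∧ᵈ def-Witnessed at (0F ∷ 3F ∷ 4F ∷ [])))

        witnessedDensely⇒forces-∈ : ∀ {p σ τ} → (M ^ ℙ) σ → (M ^ ℙ) τ →
          WitnessedDensely (p ∷ σ ∷ τ ∷ []) → Forces M ℙ p v₀∈v₁ (σ ∷ τ ∷ [])
        witnessedDensely⇒forces-∈ {p} {σ} {τ} nσ nτ w G G-generic p∈G =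
          lift (witnessed-dense {p = p} {σ} {τ} (proj₁ nσ) (proj₁ nτ) G-generic p∈G dense)
          where
          dense : ∀ {s} → s ≤ p → ∃[ q ] q ≤ s × Witnessed (q ∷ σ ∷ τ ∷ [])
          dense {s} s≤p = let (q , _ , q≤s , wq) = w s (≤⇒∈M s≤p) s≤p in q , q≤s , wq

        -- As `M` is countable, every `s ≤ p` lies in a generic filter. There `σ ∈ τ` holds, which
        -- yields a witness below `s`.
        forces-∈⇒witnessedDensely : ∀ {p σ τ} → (M ^ ℙ) σ → (M ^ ℙ) τ →
          Forces M ℙ p v₀∈v₁ (σ ∷ τ ∷ []) → WitnessedDensely (p ∷ σ ∷ τ ∷ [])
        forces-∈⇒witnessedDensely {p} {σ} {τ} nσ nτ f s _ s≤p =
          let (G , G-generic , s∈G) = generic-exists M-countable (proj₁ (≤⇒∈ s≤p))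
              (t , _ , t≤s , w) = val∈⇒witnessed {q = s} {σ} {τ} G-generic s∈G nσ nτ
                (λ _ nρ → ≐-truth (⊏-wellFounded σ) nσ nρ)
                (lower (f G G-generic (filter-upward G-generic s≤p s∈G)))
          in t , ≤⇒∈M t≤s , t≤s , w

        definability-∈ : DefinabilityLemma M ℙ v₀∈v₁
        definability-∈ = Def⇒Definable (forcing⊆M v₀∈v₁) (def-cong
          (λ { {p ∷ σ ∷ τ ∷ []} _ → mk⇔
            (λ ((p∈ℙ , nσ) , (_ , nτ) , w) →
              p∈ℙ , nσ ∷ nτ ∷ [] , witnessedDensely⇒forces-∈ nσ nτ w)
            (λ { (p∈ℙ , nσ ∷ nτ ∷ [] , f) →
              (p∈ℙ , nσ) , (p∈ℙ , nτ) , forces-∈⇒witnessedDensely nσ nτ f }) })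
          (def-NameAt at (0F ∷ 1F ∷ []) ∧ᵈ def-NameAt at (0F ∷ 2F ∷ []) ∧ᵈ def-WitnessedDensely))

        truth-∈ : TruthLemma M ℙ v₀∈v₁
        truth-∈ (σ ∷ τ ∷ []) (nσ ∷ nτ ∷ []) G G-generic (lift σ∈τ) =
          let (q , q∈G) = IsFilter.nonempty (IsGeneric.isFilter G-generic)
              (t , t∈G , _ , w) = val∈⇒witnessed {π = σ} {τ} G-generic q∈G nσ nτ
                (λ _ nρ → ≐-truth (⊏-wellFounded σ) nσ nρ) σ∈τ
          in t , t∈G , λ H H-generic t∈H → lift (witnessed⇒val∈ {π = σ} {τ} w H-generic t∈H)

        forcing-theorem-∈ : ForcingTheorem M ℙ v₀∈v₁
        forcing-theorem-∈ = definability-∈ , truth-∈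

        -- All formulae by induction

        forcing-theorem-rename : ∀ {m n} (φ : Formula m) (is : Vec (Fin n) m) →
          ForcingTheorem M ℙ φ → ForcingTheorem M ℙ (rename (lookup is) φ)
        forcing-theorem-rename {m} {n} φ is (D , T) =
          Def⇒Definable (forcing⊆M (rename (lookup is) φ)) (def-cong
            (λ { {p ∷ σs} _ → mk⇔
              (λ ((p∈ℙ , ns) , (_ , _ , f)) → p∈ℙ , ns , λ G G-generic p∈G →
                from (sat σs) (f G G-generic p∈G))
              (λ (p∈ℙ , ns , f) → (p∈ℙ , ns) , p∈ℙ , names ns , λ G G-generic p∈G →
                to (sat σs) (f G G-generic p∈G)) })
            -- The relation for `φ` constrains only the entries selected by `is`; that the others
            -- are names has to be required separately.
            (def-names n ∧ᵈ
             def-subst (λ xs → head xs ∷ map (lookup (tail xs)) is)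
               (λ { zero → zero ; (suc i) → suc (lookup is i) })
               (λ { (_ ∷ _) zero → refl ; (_ ∷ σs) (suc i) → sym (lookup-map i (lookup σs) is) })
               (Definable⇒Def D))) ,
          λ σs ns G G-generic s →
            let (p , p∈G , f) = T (map (lookup σs) is) (names ns) G G-generic (to (sat σs) s)
            in p , p∈G , λ H H-generic p∈H → from (sat σs) (f H H-generic p∈H)
          where
          names : ∀ {σs} → All (M ^ ℙ) σs → All (M ^ ℙ) (map (lookup σs) is)
          names {σs} ns = lookup⁻ λ i →
            subst (M ^ ℙ) (sym (lookup-map i (lookup σs) is)) (lookup⁺ ns (lookup is i))
          sat : ∀ {G} σs → (M [ G ]^ ℙ ⊨ rename (lookup is) φ [ map (val G) σs ]) ⇔
            (M [ G ]^ ℙ ⊨ φ [ map (val G) (map (lookup σs) is) ])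
          sat {G} σs = ⊨-rename (lookup is) φ λ i →
            trans (lookup-map (lookup is i) (val G) σs)
              (sym (trans (lookup-map i (val G) (map (lookup σs) is))
                          (cong (val G) (lookup-map i (lookup σs) is))))

        forcing-theorem-¬ : ∀ {n} (φ : Formula n) →
          ForcingTheorem M ℙ φ → ForcingTheorem M ℙ (¬′ φ)
        forcing-theorem-¬ {n} φ (D , T) =
          Def⇒Definable (forcing⊆M (¬′ φ)) (def-cong
            (λ { {p ∷ σs} _ → mk⇔
              (λ ((p∈ℙ , ns) , r) → p∈ℙ , ns , λ G G-generic p∈G →
                refuted⇒false φ T ns r G-generic p∈G)
              -- If some `q ≤ p` forced `φ`, a generic filter through `q` would make both `φ` and
              -- its negation true.
              (λ (p∈ℙ , ns , f) → (p∈ℙ , ns) , λ q _ q≤p (q∈ℙ , _ , q⊩φ) →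
                let (G , G-generic , q∈G) = generic-exists M-countable q∈ℙ
                in f G G-generic (filter-upward G-generic q≤p q∈G) (q⊩φ G G-generic q∈G)) })
            (def-names n ∧ᵈ def-refuted {φ = φ} D)) ,
          λ σs ns G G-generic ¬φ →
            let (p , p∈G , cases) = generic-meets G-generic
                  (def-specialize σs (All.map proj₁ ns)
                    (Definable⇒Def {R = Forcing φ} D ∨ᵈ def-refuted {φ = φ} D))
                  -- A condition without an extension forcing `φ` is itself refuted, so the class is
                  -- dense.
                  (λ {p} p∈ℙ → byContradiction λ ¬∃ → ¬∃ (p , ≤-refl p∈ℙ , inj₂ λ q _ q≤p q⊩φ →
                    ¬∃ (q , q≤p , inj₁ q⊩φ)))
            in p , p∈G , [ (λ (_ , _ , f) → ⊥-elim (¬φ (f G G-generic p∈G))) ,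
                           (λ r H H-generic p∈H → refuted⇒false φ T ns r H-generic p∈H) ]′ cases

        forcing-theorem-∧ : ∀ {n} (φ ψ : Formula n) →
          ForcingTheorem M ℙ φ → ForcingTheorem M ℙ ψ → ForcingTheorem M ℙ (φ ∧′ ψ)
        forcing-theorem-∧ φ ψ (Dφ , Tφ) (Dψ , Tψ) =
          Def⇒Definable (forcing⊆M (φ ∧′ ψ)) (def-cong
            (λ { {p ∷ σs} _ → mk⇔
              (λ ((p∈ℙ , ns , f) , (_ , _ , g)) → p∈ℙ , ns , λ G G-generic p∈G →
                f G G-generic p∈G , g G G-generic p∈G)
              (λ (p∈ℙ , ns , f) →
                (p∈ℙ , ns , λ G G-generic p∈G → proj₁ (f G G-generic p∈G)) ,
                (p∈ℙ , ns , λ G G-generic p∈G → proj₂ (f G G-generic p∈G))) })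
            (Definable⇒Def Dφ ∧ᵈ Definable⇒Def Dψ)) ,
          λ σs ns G G-generic (sφ , sψ) →
            let (p , p∈G , f) = Tφ σs ns G G-generic sφ
                (q , q∈G , g) = Tψ σs ns G G-generic sψ
                (r , r∈G , r≤p , r≤q) = IsFilter.directed (IsGeneric.isFilter G-generic) p∈G q∈G
            in r , r∈G , λ H H-generic r∈H →
                 forces-mono φ σs r≤p f H H-generic r∈H , forces-mono ψ σs r≤q g H H-generic r∈H

        forcing-theorem-∀ : ∀ {n} (φ : Formula (suc n)) →
          ForcingTheorem M ℙ φ → ForcingTheorem M ℙ (∀′ φ)
        forcing-theorem-∀ {n} φ (D , T) = D∀ , T∀
          where
          -- The quantifier over `σ` puts it in front of the condition, whereas a forcing relation
          -- expects the condition first.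
          swap : Fin (suc (suc n)) → Fin (suc (suc n))
          swap zero          = suc zero
          swap (suc zero)    = zero
          swap (suc (suc i)) = suc (suc i)

          swapped : Vec V (suc (suc n)) → Vec V (suc (suc n))
          swapped (x ∷ y ∷ zs) = y ∷ x ∷ zs

          lookup-swapped : ∀ xs i → lookup xs (swap i) ≡ lookup (swapped xs) i
          lookup-swapped (_ ∷ _ ∷ _) zero          = refl
          lookup-swapped (_ ∷ _ ∷ _) (suc zero)    = refl
          lookup-swapped (_ ∷ _ ∷ _) (suc (suc _)) = refl

          ForcesInstances : Vec V (suc n) → Set₁
          ForcesInstances xs =
            ∀ σ → σ ∈ M → NameAt (head xs ∷ σ ∷ []) → Forcing φ (swapped (σ ∷ xs))

          def-ForcesInstances : Def ForcesInstances
          def-ForcesInstances = def-cong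
            (λ { {_ ∷ _} _ → ⇔-id _ })
            (def-∀ (def-NameAt at (1F ∷ 0F ∷ []) →ᵈ
                    def-subst swapped swap lookup-swapped (Definable⇒Def D)))

          forces-∀⁺ : ∀ {p σs} → (∀ {σ} → (M ^ ℙ) σ → Forces M ℙ p φ (σ ∷ σs)) →
            Forces M ℙ p (∀′ φ) σs
          forces-∀⁺ f G G-generic p∈G x (σ , nσ , e) =
            ⊨-resp φ (≈-sym e ∷ Pointwise-≈-refl) (f nσ G G-generic p∈G)

          D∀ : DefinabilityLemma M ℙ (∀′ φ)
          D∀ = Def⇒Definable (forcing⊆M (∀′ φ)) (def-cong
            (λ { {p ∷ σs} _ → mk⇔
              (λ ((p∈ℙ , ns) , h) → p∈ℙ , ns , forces-∀⁺ {p} {σs} λ {σ} nσ →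
                proj₂ (proj₂ (h σ (proj₁ nσ) (p∈ℙ , nσ))))
              (λ (p∈ℙ , ns , f) → (p∈ℙ , ns) , λ σ _ (_ , nσ) → p∈ℙ , nσ ∷ ns ,
                λ G G-generic p∈G → f G G-generic p∈G (val G σ) (σ , nσ , ≈-refl)) })
            (def-names n ∧ᵈ def-ForcesInstances))

          -- The definable alternative to forcing `∀′ φ`: one fixed name whose instance is refuted.
          Counterexample : Vec V (suc n) → Set₁
          Counterexample xs = ∃[ σ ] σ ∈ M × NameAt (head xs ∷ σ ∷ []) × Refuted φ (swapped (σ ∷ xs))

          def-Counterexample : Def Counterexample
          def-Counterexample = def-cong
            (λ { {_ ∷ _} _ → ⇔-id _ })
            (def-∃ (def-NameAt at (1F ∷ 0F ∷ []) ∧ᵈ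
                    def-subst swapped swap lookup-swapped (def-refuted {φ = φ} D)))

          Decided : Vec V (suc n) → Set₁
          Decided xs = Forcing (∀′ φ) xs ⊎ Counterexample xs

          def-Decided : Def Decided
          def-Decided = Definable⇒Def {R = Forcing (∀′ φ)} D∀ ∨ᵈ def-Counterexample

          ¬forces⇒counterexample-below : ∀ {p σ σs} → (M ^ ℙ) σ → All (M ^ ℙ) σs →
            ¬ Forces M ℙ p φ (σ ∷ σs) → ∃[ q ] q ≤ p × Counterexample (q ∷ σs)
          ¬forces⇒counterexample-below {p} {σ} {σs} nσ ns p⊮φ =
            map₂ (λ (q≤p , r) → q≤p , σ , proj₁ nσ , (proj₁ (≤⇒∈ q≤p) , nσ) , r)
              (¬forces⇒refuted-below {p = p} {σ ∷ σs} φ D (nσ ∷ ns) p⊮φ)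

          decided-dense : ∀ {σs p} → All (M ^ ℙ) σs → p ∈ dom ℙ → ∃[ q ] q ≤ p × Decided (q ∷ σs)
          decided-dense {σs} {p} ns p∈ℙ with em {∃[ q ] q ≤ p × Counterexample (q ∷ σs)}
          ... | yes (q , q≤p , c) = q , q≤p , inj₂ c
          -- If an instance at `σ` were not forced by `p`, some extension of `p` would refute it and
          -- so be a `Counterexample`.
          ... | no ¬c = p , ≤-refl p∈ℙ , inj₁ (p∈ℙ , ns , forces-∀⁺ {p} {σs} λ {σ} nσ →
                byContradiction {Forces M ℙ p φ (σ ∷ σs)} λ p⊮φ →
                  ¬c (¬forces⇒counterexample-below nσ ns p⊮φ))

          decided⇒forces : ∀ {σs p G} → All (M ^ ℙ) σs → IsGeneric M ℙ G → p ∈ G →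
            (M [ G ]^ ℙ ⊨ ∀′ φ [ map (val G) σs ]) → Decided (p ∷ σs) → Forces M ℙ p (∀′ φ) σs
          decided⇒forces ns G-generic p∈G s (inj₁ (_ , _ , f)) = f
          decided⇒forces {σs} {p} {G} ns G-generic p∈G s (inj₂ (σ , _ , (_ , nσ) , r)) = ⊥-elim
            (refuted⇒false {p = p} {σ ∷ σs} φ T (nσ ∷ ns) r G-generic p∈G
              (s (val G σ) (σ , nσ , ≈-refl)))

          T∀ : TruthLemma M ℙ (∀′ φ)
          T∀ σs ns G G-generic s =
            let (p , p∈G , d) = generic-meets G-generic
                  (def-specialize {k = 1} σs (All.map proj₁ ns) def-Decided) (decided-dense ns)
            in p , p∈G , decided⇒forces ns G-generic p∈G s d

        forcing-theorem : ∀ {n} (φ : Formula n) → ForcingTheorem M ℙ φ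
        forcing-theorem (i ∈′ j) = forcing-theorem-rename v₀∈v₁ (i ∷ j ∷ []) forcing-theorem-∈
        forcing-theorem (i ≐′ j) = forcing-theorem-rename v₀≐v₁ (i ∷ j ∷ []) forcing-theorem-≐
        forcing-theorem (¬′ φ)   = forcing-theorem-¬ φ (forcing-theorem φ)
        forcing-theorem (φ ∧′ ψ) = forcing-theorem-∧ φ ψ (forcing-theorem φ) (forcing-theorem ψ)
        forcing-theorem (∀′ φ)   = forcing-theorem-∀ φ (forcing-theorem φ)

theorem1p1 : ExcludedMiddle (lsuc 0ℓ) →
    (M : V) → Countable M → Transitive M → ZF⁻ M →
    (ℙ : PartialOrder) → DefinableOrder M ℙ →
    DefinabilityLemma M ℙ v₀∈v₁ ⊎ DefinabilityLemma M ℙ v₀≐v₁ →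
    (n : ℕ) (φ : Formula n) → ForcingTheorem M ℙ φ
theorem1p1 em M M-countable M-transitive zf ℙ ℙ-definable D n φ =
  forcing-theorem em M M-transitive ℙ ℙ-definable M-countable
    -- Both hypotheses are brought to definability for equality, from which the whole induction
    -- starts.
    ([ definability-≐-from-∈ em M M-transitive ℙ ℙ-definable zf , id ]′ D) φ
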